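{- Satisfiability of a given GAF sentence $\varphi$ without equality is decidable, even if $\varphi$ contains arbitrarily nested unary function symbols.
   Context: A first-order sentence $\varphi$ is in standard form if $\varphi = \forall \vec{x}_1 \exists \vec{y}_1 \ldots \forall \vec{x}_n \exists \vec{y}_n.\,\psi$, where the $\vec{x}_i,\vec{y}_i$ are tuples of variables ($\vec{x}_1$ and $\vec{y}_n$ may be empty), $\psi$ is quantifier-free, in negation normal form and uses only $\wedge,\vee,\neg$, every variable bound in the prefix occurs in $\psi$, and no variable is bound twice. Here terms may be built from variables, constant symbols and unary function symbols (arbitrarily nested); there is no equality. Let $\vec{x}:=\bigcup_i\vec{x}_i$, $\vec{y}:=\bigcup_i\vec{y}_i$, let $\mathrm{At}$ be the set of atoms of $\varphi$, $\mathrm{vars}(S)$ the set of variables occurring in a set $S$ of atoms, and for $v\in\vec{x}\cup\vec{y}$ let $\mathrm{idx}(v):=k$ iff $v\in\vec{x}_k$ or $v\in\vec{y}_k$. The sentence belongs to the generalized Ackermann fragment (GAF) iff $\mathrm{At}$ can be partitioned into sets $\mathrm{At}_0$ and $\mathrm{At}_x$, $x\in\vec{x}$, such that (a) $\mathrm{vars}(\mathrm{At}_0)\cap\vec{x}=\emptyset$; (b) for every $x\in\vec{x}$, $\mathrm{vars}(\mathrm{At}_x)\cap\vec{x}=\{x\}$; (c) for every $y\in\vec{y}$ occurring in some $\mathrm{At}_x$, exactly one of: (c.1) for every $\mathrm{At}_x$ in which $y$ occurs, $\mathrm{idx}(y)<\mathrm{idx}(x)$; or (c.2) there is exactly one $\mathrm{At}_x$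 in which $y$ occurs, $y$ does not occur in $\mathrm{At}_0$, and $\mathrm{idx}(y)\ge\mathrm{idx}(x)$. -}

module Defs where

open import Data.Nat using (ℕ; zero; suc; _<_; _≤_; _≡ᵇ_)
open import Data.Bool using (Bool; true; false; if_then_else_; _∨_)
open import Data.List using (List; []; _∷_; _++_; map; concatMap)
open import Data.List.Membership.Propositional using (_∈_; _∉_)
open import Data.List.Relation.Unary.All using (All)
open import Data.List.Relation.Unary.Unique.Propositional using (Unique)
open import Data.Maybe using (Maybe; just; nothing)
open import Data.Product using (Σ; _×_; ∃; ∃-syntax)
open import Data.Sum using (_⊎_)
open import Data.Unit using (⊤)
open import Relation.Nullary using (¬_)
open import Relation.Binary.PropositionalEquality using (_≡_)

Var : Set
Var = ℕ

data Term : Set where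
  var : Var → Term
  con : ℕ → Term
  fun : ℕ → Term → Term

-- An atom P(t₁,…,tₘ).  The predicate symbol is the pair (name, m);
-- a structure interprets each name on argument lists of every length.
record Atom : Set where
  constructor atom
  field
    pred : ℕ
    args : List Term

data QF : Set where
  pos  : Atom → QF
  neg  : Atom → QF
  _∧ᶠ_ : QF → QF → QF
  _∨ᶠ_ : QF → QF → QF

-- One quantifier block  ∀ x⃗ᵢ ∃ y⃗ᵢ.
record Block : Set where
  constructor block
  field
    xs : List Var
    ys : List Var
open Block public

record Sentence : Set where
  constructor _·_
  field
    prefix : List Block
    matrix : QF
open Sentence public

varsT : Term → List Var
varsT (var v)   = v ∷ []
varsT (con c)   = []
varsT (fun f t) = varsT t

varsA : Atom → List Var
varsA (atom p ts) = concatMap varsT ts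

atoms : QF → List Atom
atoms (pos a)    = a ∷ []
atoms (neg a)    = a ∷ []
atoms (φ ∧ᶠ ψ)   = atoms φ ++ atoms ψ
atoms (φ ∨ᶠ ψ)   = atoms φ ++ atoms ψ

varsQF : QF → List Var
varsQF ψ = concatMap varsA (atoms ψ)

univVars : List Block → List Var
univVars = concatMap xs

exVars : List Block → List Var
exVars = concatMap ys

boundVars : List Block → List Var
boundVars = concatMap (λ b → xs b ++ ys b)

memb : Var → List Var → Bool
memb v []       = false
memb v (w ∷ ws) = (v ≡ᵇ w) ∨ memb v ws

-- idx(v) = k iff v ∈ x⃗ₖ or v ∈ y⃗ₖ  (blocks counted from 0 here; only
-- comparisons of indices are used)
idx : List Block → Var → ℕ
idx []       v = 0
idx (b ∷ bs) v = if memb v (xs b ++ ys b) then 0 else suc (idx bs v)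

data NonEmpty {A : Set} : List A → Set where
  nonEmpty : ∀ {a as} → NonEmpty (a ∷ as)

ysShape : List Block → Set
ysShape []            = ⊤
ysShape (b ∷ [])      = ⊤
ysShape (b ∷ b′ ∷ bs) = NonEmpty (ys b) × ysShape (b′ ∷ bs)

xsShape : List Block → Set
xsShape []       = ⊤
xsShape (b ∷ bs) = All (λ b′ → NonEmpty (xs b′)) bs

record StandardForm (φ : Sentence) : Set where
  field
    shape-xs    : xsShape (prefix φ)
    shape-ys    : ysShape (prefix φ)
    closed      : ∀ {v} → v ∈ varsQF (matrix φ) → v ∈ boundVars (prefix φ)
    allOccur    : ∀ {v} → v ∈ boundVars (prefix φ) → v ∈ varsQF (matrix φ)
    boundOnce   : Unique (boundVars (prefix φ))

-- The generalized Ackermann fragment.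
-- A partition of At into At₀ and At_x (x ∈ x⃗) is given by a labelling
-- of atoms: nothing ↦ At₀, just x ↦ At_x.

record GAFPartition (φ : Sentence) (lab : Atom → Maybe Var) : Set where
  At = atoms (matrix φ)
  X  = univVars (prefix φ)
  Y  = exVars (prefix φ)
  ix = idx (prefix φ)
  OccIn : Var → Var → Set
  OccIn y x = ∃[ a ] (a ∈ At × lab a ≡ just x × y ∈ varsA a)
  C1 : Var → Set
  C1 y = ∀ {x} → OccIn y x → ix y < ix x
  C2 : Var → Set
  C2 y = ∃[ x ] ( OccIn y x
                × (∀ {x′} → OccIn y x′ → x′ ≡ x)
                × (∀ {a} → a ∈ At → lab a ≡ nothing → y ∉ varsA a)
                × ix x ≤ ix y )
  field
    labels  : ∀ {a x} → a ∈ At → lab a ≡ just x → x ∈ X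
    condA   : ∀ {a v} → a ∈ At → lab a ≡ nothing → v ∈ varsA a → v ∉ X
    condB⊆  : ∀ {a x v} → a ∈ At → lab a ≡ just x → v ∈ varsA a → v ∈ X → v ≡ x
    condB⊇  : ∀ {x} → x ∈ X → OccIn x x
    condC   : ∀ {y x} → y ∈ Y → OccIn y x → (C1 y ⊎ C2 y) × ¬ (C1 y × C2 y)

IsGAF : Sentence → Set
IsGAF φ = StandardForm φ × Σ (Atom → Maybe Var) (GAFPartition φ)

record Structure : Set₁ where
  field
    Dom  : Set
    elem : Dom
    cst  : ℕ → Dom
    fn   : ℕ → Dom → Dom
    rel  : ℕ → List Dom → Set

module _ (M : Structure) where
  open Structure M

  Env : Set
  Env = Var → Dom

  _[_↦_] : Env → Var → Dom → Env
  (ρ [ x ↦ d ]) v = if v ≡ᵇ x then d else ρ v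

  evalT : Env → Term → Dom
  evalT ρ (var v)   = ρ v
  evalT ρ (con c)   = cst c
  evalT ρ (fun f t) = fn f (evalT ρ t)

  holdsA : Env → Atom → Set
  holdsA ρ (atom p ts) = rel p (map (evalT ρ) ts)

  satQF : Env → QF → Set
  satQF ρ (pos a)  = holdsA ρ a
  satQF ρ (neg a)  = ¬ holdsA ρ a
  satQF ρ (φ ∧ᶠ ψ) = satQF ρ φ × satQF ρ ψ
  satQF ρ (φ ∨ᶠ ψ) = satQF ρ φ ⊎ satQF ρ ψ

  satAll : List Var → (Env → Set) → Env → Set
  satAll []       K ρ = K ρ
  satAll (x ∷ vs) K ρ = (d : Dom) → satAll vs K (ρ [ x ↦ d ])

  satEx : List Var → (Env → Set) → Env → Set
  satEx []       K ρ = K ρ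
  satEx (x ∷ vs) K ρ = Σ Dom (λ d → satEx vs K (ρ [ x ↦ d ]))

  satPrefix : List Block → QF → Env → Set
  satPrefix []       ψ ρ = satQF ρ ψ
  satPrefix (b ∷ bs) ψ ρ = satAll (xs b) (satEx (ys b) (satPrefix bs ψ)) ρ

  _⊨_ : Sentence → Set
  _⊨_ φ = satPrefix (prefix φ) (matrix φ) (λ _ → elem)

Satisfiable : Sentence → Set₁
Satisfiable φ = Σ Structure (λ M → M ⊨ φ)

{-# OPTIONS --safe #-}
module Submission where

open import Defs
open import Data.Bool using (Bool; T; true; false; if_then_else_)
open import Data.Empty using (⊥; ⊥-elim)
open import Data.List using (List; []; _∷_; _++_; map; foldr; filter; cartesianProductWith; length; concatMap; take; drop)
open import Data.List.Membership.Propositional using (_∈_; find; lose; _∉_)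
open import Data.List.Membership.Propositional.Properties using (∈-++⁺ˡ; ∈-++⁺ʳ; ∈-++⁻; ∈-map⁺; ∈-map⁻; ∈-filter⁺; ∈-filter⁻; ∈-cartesianProductWith⁺; ∈-cartesianProductWith⁻; ∈-concatMap⁺; ∈-concatMap⁻)
open import Data.List.Properties using (map-cong; ++-assoc; ++-identityʳ; map-id; map-∘; length-++; length-map; map-cong-local)
open import Data.List.Relation.Unary.All as All using (All; []; _∷_)
open import Data.List.Relation.Unary.AllPairs using ([]; _∷_)
open import Data.List.Relation.Unary.Any as Any using (Any; here; there)
open import Data.List.Relation.Unary.Unique.Propositional using (Unique)
open import Data.Maybe using (Maybe; just; nothing)
open import Data.Nat using (ℕ; _≡ᵇ_; _≟_; _<_; _≤_; z≤n; s≤s; zero; suc; _+_; _∸_; _≤?_; _<?_; _⊔_)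
open import Data.Nat.Properties using (≡ᵇ⇒≡; <⇒≱; ≤-reflexive; <⇒≤; ≤-refl; ≤-trans; m≤m+n; m≤n+m; +-assoc; +-comm; +-mono-≤; m≤n⇒m⊓n≡m; +-cancelˡ-≤; ≰⇒>; ≮⇒≥; ≡-irrelevant; m+[n∸m]≡n; <-≤-trans; m≤n⇒m≤1+n; n≤1+n; m⊔n≤o⇒m≤o; m⊔n≤o⇒n≤o)
open import Data.Product using (Σ; _×_; _,_; proj₁; proj₂; ∃)
open import Data.Sum using (_⊎_; inj₁; inj₂; [_,_]′)
open import Data.Unit using (⊤; tt)
open import Function using (_∘_; id)
open import Relation.Binary using (DecidableEquality)
open import Relation.Binary.PropositionalEquality using (_≡_; _≢_; refl; sym; trans; cong; cong₂; subst)
open import Relation.Nullary using (¬_; Dec; yes; no)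
open import Relation.Nullary.Decidable using (¬?; _×-dec_; _⊎-dec_; ¬¬-excluded-middle; _→-dec_; decidable-stable; map′)
import Data.Bool.Properties as Bool
import Data.List.Membership.DecPropositional as DecMembership
import Data.List.Properties as List
import Data.Maybe.Properties as Maybe
import Data.Product.Properties as Product
import Data.Sum as Sum
import Data.Sum.Properties as Sum

-- Pushing every quantifier of a GAF sentence inwards as far as possible (∃ over
-- a disjunctive, ∀ over a conjunctive normal form) leaves no ∀ in the scope of
-- another ∀: units stay within one part At_x until x is quantified, and a
-- variable y of type (c.1) is quantified only after every x with y in At_x.
-- After guessing the disjuncts outside the universal quantifiers and
-- Skolemizing, what remains is a single constraint ∀x χ(x) in which all terms
-- are words of unary functions applied to x or to a root.  Such a constraint
-- is satisfiable iff it holds in a relation on the tree of all words, and this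
-- is decided by searching for a finite set of types (truth values of the atoms
-- in the window of depth k above a node) that satisfies χ and is closed under
-- successors.
--
-- Satisfaction is constructive, so miniscoping is used as a strong implication
-- from the result to the sentence and a classical (¬¬) one in the other
-- direction; the latter suffices because certificates are decidable.

-- Formulas and miniscoping

-- The roots complicate the type argument. In the window of a node near the top of the tree, a local
-- address and a root may name the same word, so that truth values assigned per scheme could
-- contradict each other. A node deeper than `k` admits no such coincidence, because the roots in
-- schemes have length at most `k`. Hence types describe the deep nodes only, and the atoms over
-- words of length at most 2k + 1 are fixed separately by `G`, which also makes all branches agree
-- on atoms about roots alone.
--
-- On the side of a given model, Skolem functions on the whole domain would require choice, and ¬¬
-- does not help, since it does not in general commute with quantifiers over infinite domains.
-- Everything extracted from a model is therefore confined to trees of finite depth over a finite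
-- alphabet, where finitely many double negations can be combined.

data Fm : Set where
  lit         : Bool → Atom → Fm
  ⊤ᶠ ⊥ᶠ       : Fm
  _⩓_ _⩔_     : Fm → Fm → Fm
  ex all      : Var → Fm → Fm

FV : Var → Fm → Set
FV v (lit _ a) = v ∈ varsA a
FV v ⊤ᶠ        = ⊥
FV v ⊥ᶠ        = ⊥
FV v (A ⩓ B)   = FV v A ⊎ FV v B
FV v (A ⩔ B)   = FV v A ⊎ FV v B
FV v (ex w A)  = v ≢ w × FV v A
FV v (all w A) = v ≢ w × FV v A

open DecMembership _≟_ using () renaming (_∈?_ to _∈ⱽ?_)

FV? : ∀ v A → Dec (FV v A)
FV? v (lit _ a) = v ∈ⱽ? varsA a
FV? v ⊤ᶠ        = no λ ()
FV? v ⊥ᶠ        = no λ ()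
FV? v (A ⩓ B)   = FV? v A ⊎-dec FV? v B
FV? v (A ⩔ B)   = FV? v A ⊎-dec FV? v B
FV? v (ex w A)  = ¬? (v ≟ w) ×-dec FV? v A
FV? v (all w A) = ¬? (v ≟ w) ×-dec FV? v A

⋀ ⋁ : List Fm → Fm
⋀ = foldr _⩓_ ⊤ᶠ
⋁ = foldr _⩔_ ⊥ᶠ

dnf : Fm → List (List Fm)
dnf ⊤ᶠ      = [] ∷ []
dnf ⊥ᶠ      = []
dnf (A ⩓ B) = cartesianProductWith _++_ (dnf A) (dnf B)
dnf (A ⩔ B) = dnf A ++ dnf B
dnf A       = (A ∷ []) ∷ []

cnf : Fm → List (List Fm)
cnf ⊤ᶠ      = []
cnf ⊥ᶠ      = [] ∷ []
cnf (A ⩓ B) = cnf A ++ cnf B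
cnf (A ⩔ B) = cartesianProductWith _++_ (cnf A) (cnf B)
cnf A       = (A ∷ []) ∷ []

with-var without-var : Var → List Fm → List Fm
with-var    v = filter (FV? v)
without-var v = filter (λ A → ¬? (FV? v A))

exConj : Var → List Fm → Fm
exConj v c = ⋀ (without-var v c) ⩓ ex v (⋀ (with-var v c))

allDisj : Var → List Fm → Fm
allDisj v c = ⋁ (without-var v c) ⩔ all v (⋁ (with-var v c))

pushEx pushAll : Var → Fm → Fm
pushEx  v A = ⋁ (map (exConj v) (dnf A))
pushAll v A = ⋀ (map (allDisj v) (cnf A))

pushExs pushAlls : List Var → Fm → Fm
pushExs  vs A = foldr pushEx A vs
pushAlls vs A = foldr pushAll A vs

toFm : QF → Fm
toFm (pos a)  = lit true a
toFm (neg a)  = lit false a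
toFm (φ ∧ᶠ ψ) = toFm φ ⩓ toFm ψ
toFm (φ ∨ᶠ ψ) = toFm φ ⩔ toFm ψ

miniscope : List Block → QF → Fm
miniscope []       ψ = toFm ψ
miniscope (b ∷ bs) ψ = pushAlls (xs b) (pushExs (ys b) (miniscope bs ψ))

∈-split-var : ∀ v c {A} → A ∈ c → A ∈ without-var v c ⊎ A ∈ with-var v c
∈-split-var v c {A} A∈c with FV? v A
... | yes p = inj₂ (∈-filter⁺ (FV? v) A∈c p)
... | no ¬p = inj₁ (∈-filter⁺ (λ A → ¬? (FV? v A)) A∈c ¬p)

∈-without-var : ∀ v c {A} → A ∈ without-var v c → A ∈ c × ¬ FV v A
∈-without-var v c = ∈-filter⁻ (λ A → ¬? (FV? v A)) {xs = c}

∈-with-var : ∀ v c {A} → A ∈ with-var v c → A ∈ c × FV v A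
∈-with-var v c = ∈-filter⁻ (FV? v) {xs = c}

if-cong : ∀ {A : Set} (b : Bool) {d : A} {p q : A} → (b ≡ false → p ≡ q) → (if b then d else p) ≡ (if b then d else q)
if-cong true  _ = refl
if-cong false h = h refl

≡ᵇ-false : ∀ v w → v ≢ w → (v ≡ᵇ w) ≡ false
≡ᵇ-false v w v≢w with v ≡ᵇ w in eq
... | false = refl
... | true  = ⊥-elim (v≢w (≡ᵇ⇒≡ v w (subst T (sym eq) tt)))

≡ᵇ-refl : ∀ v → (v ≡ᵇ v) ≡ true
≡ᵇ-refl zero    = refl
≡ᵇ-refl (suc v) = ≡ᵇ-refl v

≡ᵇ-false⁻ : ∀ v w → (v ≡ᵇ w) ≡ false → v ≢ w
≡ᵇ-false⁻ v .v eq refl with trans (sym eq) (≡ᵇ-refl v)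
... | ()

-- Satisfaction with disjunctions, existentials and positive literals under
-- a modality J: J = id is the semantics of the statement, J = ¬¬ classical logic.
module Semantics (J : Set → Set) (pure : ∀ {A : Set} → A → J A)
                 (bind : ∀ {A B : Set} → J A → (A → J B) → J B)
                 (M : Structure) where
  open Structure M

  private
    upd : Env M → Var → Dom → Env M
    upd = _[_↦_] M

  -- Negation, conjunction and ∀ preserve stability under double negation and so carry no `J`; `⊥ᶠ`
  -- carries it as the empty disjunction.
  sat : Env M → Fm → Set
  sat ρ (lit true a)  = J (holdsA M ρ a)
  sat ρ (lit false a) = ¬ holdsA M ρ a
  sat ρ ⊤ᶠ            = ⊤
  sat ρ ⊥ᶠ            = J ⊥
  sat ρ (A ⩓ B)       = sat ρ A × sat ρ B
  sat ρ (A ⩔ B)       = J (sat ρ A ⊎ sat ρ B)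
  sat ρ (ex v A)      = J (Σ Dom λ d → sat (upd ρ v d) A)
  sat ρ (all v A)     = ∀ d → sat (upd ρ v d) A

  evalT-cong : ∀ {ρ ρ′} t → (∀ v → v ∈ varsT t → ρ v ≡ ρ′ v) → evalT M ρ t ≡ evalT M ρ′ t
  evalT-cong (var v)   h = h v (here refl)
  evalT-cong (con c)   h = refl
  evalT-cong (fun f t) h = cong (fn f) (evalT-cong t h)

  evalTs-cong : ∀ {ρ ρ′} ts → (∀ v → v ∈ concatMap varsT ts → ρ v ≡ ρ′ v) →
                map (evalT M ρ) ts ≡ map (evalT M ρ′) ts
  evalTs-cong []       h = refl
  evalTs-cong (t ∷ ts) h =
    cong₂ _∷_ (evalT-cong t λ v m → h v (∈-++⁺ˡ m)) (evalTs-cong ts λ v m → h v (∈-++⁺ʳ (varsT t) m))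

  private
    jmap : ∀ {A B : Set} → (A → B) → J A → J B
    jmap f m = bind m (pure ∘ f)

    upd-agree : ∀ {ρ ρ′ : Env M} v d {A} → (∀ w → w ≢ v × FV w A → ρ w ≡ ρ′ w) →
                ∀ w → FV w A → upd ρ v d w ≡ upd ρ′ v d w
    upd-agree v d h w m = if-cong (w ≡ᵇ v) λ eq → h w (≡ᵇ-false⁻ w v eq , m)

  sat-agree : ∀ {ρ ρ′} A → (∀ v → FV v A → ρ v ≡ ρ′ v) → sat ρ A → sat ρ′ A
  sat-agree (lit true (atom p ts))  h = jmap (subst (rel p) (evalTs-cong ts h))
  sat-agree (lit false (atom p ts)) h = λ n → n ∘ subst (rel p) (sym (evalTs-cong ts h))
  sat-agree ⊤ᶠ        h = id
  sat-agree ⊥ᶠ        h = id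
  sat-agree (A ⩓ B)   h (p , q) = sat-agree A (λ v → h v ∘ inj₁) p , sat-agree B (λ v → h v ∘ inj₂) q
  sat-agree (A ⩔ B)   h = jmap (Sum.map (sat-agree A (λ v → h v ∘ inj₁)) (sat-agree B (λ v → h v ∘ inj₂)))
  sat-agree (ex v A)  h = jmap λ (d , p) → d , sat-agree A (upd-agree v d {A} h) p
  sat-agree (all v A) h p d = sat-agree A (upd-agree v d {A} h) (p d)

  sat-upd : ∀ {ρ} v d A → ¬ FV v A → sat ρ A → sat (upd ρ v d) A
  sat-upd {ρ} v d A v∉ = sat-agree A λ w w∈ →
    sym (cong (if_then d else ρ w) (≡ᵇ-false w v λ { refl → v∉ w∈ }))

  sat-upd⁻ : ∀ {ρ} v d A → ¬ FV v A → sat (upd ρ v d) A → sat ρ A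
  sat-upd⁻ {ρ} v d A v∉ = sat-agree A λ w w∈ →
    cong (if_then d else ρ w) (≡ᵇ-false w v λ { refl → v∉ w∈ })

  ⋀⁺ : ∀ {ρ} c → (∀ {A} → A ∈ c → sat ρ A) → sat ρ (⋀ c)
  ⋀⁺ []      h = tt
  ⋀⁺ (A ∷ c) h = h (here refl) , ⋀⁺ c (h ∘ there)

  ⋀⁻ : ∀ {ρ c} → sat ρ (⋀ c) → ∀ {A} → A ∈ c → sat ρ A
  ⋀⁻ (p , q) (here refl) = p
  ⋀⁻ (p , q) (there m)   = ⋀⁻ q m

  ⋁⁺ : ∀ {ρ c A} → A ∈ c → sat ρ A → sat ρ (⋁ c)
  ⋁⁺ (here refl) p = pure (inj₁ p)
  ⋁⁺ (there m)   p = pure (inj₂ (⋁⁺ m p))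

  ⋁⁻ : ∀ {ρ} c → sat ρ (⋁ c) → J (∃ λ A → A ∈ c × sat ρ A)
  ⋁⁻ []      p = bind p ⊥-elim
  ⋁⁻ (A ∷ c) p = bind p λ where
    (inj₁ q) → pure (A , here refl , q)
    (inj₂ q) → jmap (λ (B , m , r) → B , there m , r) (⋁⁻ c q)

  SomeIn : Env M → List Fm → Set
  SomeIn ρ c = ∃ λ A → A ∈ c × sat ρ A

  SomeConj AllDisj : Env M → List (List Fm) → Set
  SomeConj ρ cs = ∃ λ c → c ∈ cs × (∀ A → A ∈ c → sat ρ A)
  AllDisj  ρ cs = ∀ c → c ∈ cs → SomeIn ρ c

  private
    unit-some : ∀ {ρ A} → sat ρ A → SomeConj ρ ((A ∷ []) ∷ [])
    unit-some p = _ , here refl , λ { _ (here refl) → p }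

    unit-some⁻ : ∀ {ρ A} → SomeConj ρ ((A ∷ []) ∷ []) → sat ρ A
    unit-some⁻ (_ , here refl , h) = h _ (here refl)

    unit-all : ∀ {ρ A} → sat ρ A → AllDisj ρ ((A ∷ []) ∷ [])
    unit-all p _ (here refl) = _ , here refl , p

    unit-all⁻ : ∀ {ρ A} → AllDisj ρ ((A ∷ []) ∷ []) → sat ρ A
    unit-all⁻ h with h _ (here refl)
    ... | _ , here refl , p = p

    weakenˡ : ∀ {ρ c c′} → SomeIn ρ c → SomeIn ρ (c ++ c′)
    weakenˡ (A , m , p) = A , ∈-++⁺ˡ m , p

    weakenʳ : ∀ {ρ} c {c′} → SomeIn ρ c′ → SomeIn ρ (c ++ c′)
    weakenʳ c (A , m , p) = A , ∈-++⁺ʳ c m , p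

    unappend : ∀ {ρ} c {c′} → SomeIn ρ (c ++ c′) → SomeIn ρ c ⊎ SomeIn ρ c′
    unappend c (A , m , p) = Sum.map (λ m → A , m , p) (λ m → A , m , p) (∈-++⁻ c m)

    -- Constructive because the list is finite: the first `P` met is returned, and otherwise every
    -- entry has supplied its `Q`.
    distribʳ : ∀ {P : Set} {Q : List Fm → Set} cs → (∀ c → c ∈ cs → P ⊎ Q c) → P ⊎ (∀ c → c ∈ cs → Q c)
    distribʳ []       h = inj₂ λ _ ()
    distribʳ (c ∷ cs) h with h c (here refl) | distribʳ cs (λ c → h c ∘ there)
    ... | inj₁ p | _      = inj₁ p
    ... | inj₂ q | inj₁ p = inj₁ p
    ... | inj₂ q | inj₂ r = inj₂ λ { _ (here refl) → q ; c (there m) → r c m }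

  dnf-sound : ∀ {ρ} A → SomeConj ρ (dnf A) → sat ρ A
  dnf-sound (lit b a) h = unit-some⁻ {A = lit b a} h
  dnf-sound ⊤ᶠ        h = tt
  dnf-sound (A ⩓ B) (c , m , h) with ∈-cartesianProductWith⁻ _++_ (dnf A) (dnf B) m
  ... | c₁ , c₂ , m₁ , m₂ , refl =
    dnf-sound A (c₁ , m₁ , λ C → h C ∘ ∈-++⁺ˡ) , dnf-sound B (c₂ , m₂ , λ C → h C ∘ ∈-++⁺ʳ c₁)
  dnf-sound (A ⩔ B) (c , m , h) with ∈-++⁻ (dnf A) m
  ... | inj₁ m₁ = pure (inj₁ (dnf-sound A (c , m₁ , h)))
  ... | inj₂ m₂ = pure (inj₂ (dnf-sound B (c , m₂ , h)))
  dnf-sound (ex v A)  h = unit-some⁻ {A = ex v A} h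
  dnf-sound (all v A) h = unit-some⁻ {A = all v A} h

  dnf-complete : ∀ {ρ} A → sat ρ A → J (SomeConj ρ (dnf A))
  dnf-complete (lit b a) p = pure (unit-some {A = lit b a} p)
  dnf-complete ⊤ᶠ        p = pure (_ , here refl , λ _ ())
  dnf-complete ⊥ᶠ        p = bind p ⊥-elim
  dnf-complete (A ⩓ B) (p , q) =
    bind (dnf-complete A p) λ (c₁ , m₁ , h₁) → bind (dnf-complete B q) λ (c₂ , m₂ , h₂) →
    pure (c₁ ++ c₂ , ∈-cartesianProductWith⁺ _++_ m₁ m₂ , λ C m → [ h₁ C , h₂ C ]′ (∈-++⁻ c₁ m))
  dnf-complete (A ⩔ B) p = bind p λ where
    (inj₁ q) → jmap (λ (c , m , h) → c , ∈-++⁺ˡ m , h) (dnf-complete A q)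
    (inj₂ q) → jmap (λ (c , m , h) → c , ∈-++⁺ʳ (dnf A) m , h) (dnf-complete B q)
  dnf-complete (ex v A)  p = pure (unit-some {A = ex v A} p)
  dnf-complete (all v A) p = pure (unit-some {A = all v A} p)

  cnf-sound : ∀ {ρ} A → AllDisj ρ (cnf A) → sat ρ A
  cnf-sound (lit b a) h = unit-all⁻ {A = lit b a} h
  cnf-sound ⊤ᶠ        h = tt
  cnf-sound ⊥ᶠ        h with h _ (here refl)
  ... | _ , () , _
  cnf-sound (A ⩓ B)   h = cnf-sound A (λ c → h c ∘ ∈-++⁺ˡ) , cnf-sound B (λ c → h c ∘ ∈-++⁺ʳ (cnf A))
  -- Distributing twice: a clause of `A` has a true member or else all clauses of `B` do, and then
  -- the same alternative is decided over all clauses of `A`.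
  cnf-sound {ρ} (A ⩔ B) h = pure (Sum.map (cnf-sound A) (cnf-sound B) (Sum.swap
    (distribʳ (cnf A) λ c₁ m₁ → Sum.swap (distribʳ {Q = SomeIn ρ} (cnf B) λ c₂ m₂ →
      unappend c₁ (h _ (∈-cartesianProductWith⁺ _++_ m₁ m₂))))))
  cnf-sound (ex v A)  h = unit-all⁻ {A = ex v A} h
  cnf-sound (all v A) h = unit-all⁻ {A = all v A} h

  cnf-complete : ∀ {ρ} A → sat ρ A → J (AllDisj ρ (cnf A))
  cnf-complete (lit b a) p = pure (unit-all {A = lit b a} p)
  cnf-complete ⊤ᶠ        p = pure λ _ ()
  cnf-complete ⊥ᶠ        p = bind p ⊥-elim
  cnf-complete (A ⩓ B) (p , q) =
    bind (cnf-complete A p) λ h₁ → bind (cnf-complete B q) λ h₂ →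
    pure λ c m → [ h₁ c , h₂ c ]′ (∈-++⁻ (cnf A) m)
  cnf-complete {ρ} (A ⩔ B) p = bind p λ where
      (inj₁ q) → jmap left (cnf-complete A q)
      (inj₂ q) → jmap right (cnf-complete B q)
    where
    left : AllDisj ρ (cnf A) → AllDisj ρ (cnf (A ⩔ B))
    left h c m with ∈-cartesianProductWith⁻ _++_ (cnf A) (cnf B) m
    ... | c₁ , c₂ , m₁ , m₂ , refl = weakenˡ (h c₁ m₁)
    right : AllDisj ρ (cnf B) → AllDisj ρ (cnf (A ⩔ B))
    right h c m with ∈-cartesianProductWith⁻ _++_ (cnf A) (cnf B) m
    ... | c₁ , c₂ , m₁ , m₂ , refl = weakenʳ c₁ (h c₂ m₂)
  cnf-complete (ex v A)  p = pure (unit-all {A = ex v A} p)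
  cnf-complete (all v A) p = pure (unit-all {A = all v A} p)

-- Miniscoping under the strong and the classical semantics

¬¬_ : Set → Set
¬¬ A = ¬ ¬ A
infix 3 ¬¬_

return : ∀ {A : Set} → A → ¬¬ A
return a k = k a

_>>=_ : ∀ {A B : Set} → ¬¬ A → (A → ¬¬ B) → ¬¬ B
(m >>= f) k = m λ a → f a k

module Strong    = Semantics id id (λ a f → f a)
module Classical = Semantics ¬¬_ return _>>=_

satAll-mono : ∀ M vs {K K′ : Env M → Set} → (∀ ρ → K ρ → K′ ρ) → ∀ ρ → satAll M vs K ρ → satAll M vs K′ ρ
satAll-mono M []       h ρ p   = h ρ p
satAll-mono M (v ∷ vs) h ρ p d = satAll-mono M vs h _ (p d)

satEx-mono : ∀ M vs {K K′ : Env M → Set} → (∀ ρ → K ρ → K′ ρ) → ∀ ρ → satEx M vs K ρ → satEx M vs K′ ρ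
satEx-mono M []       h ρ p       = h ρ p
satEx-mono M (v ∷ vs) h ρ (d , p) = d , satEx-mono M vs h _ p

module _ (M : Structure) where
  open Structure M
  open Strong M

  pushEx-sound : ∀ v A {ρ} → sat ρ (pushEx v A) → Σ Dom λ d → sat (_[_↦_] M ρ v d) A
  pushEx-sound v A p with ⋁⁻ (map (exConj v) (dnf A)) p
  ... | _ , m , q with ∈-map⁻ (exConj v) m
  pushEx-sound v A p | _ , m , (q₁ , d , q₂) | c , c∈ , refl = d , dnf-sound A (c , c∈ , λ B B∈c →
    [ (λ m → sat-upd v d B (proj₂ (∈-without-var v c m)) (⋀⁻ q₁ m)) , ⋀⁻ q₂ ]′ (∈-split-var v c B∈c))

  pushAll-sound : ∀ v A {ρ} → sat ρ (pushAll v A) → ∀ d → sat (_[_↦_] M ρ v d) A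
  pushAll-sound v A {ρ} p d = cnf-sound A λ c m → clause c (⋀⁻ p (∈-map⁺ (allDisj v) m))
    where
    clause : ∀ c → sat ρ (allDisj v c) → ∃ λ B → B ∈ c × sat (_[_↦_] M ρ v d) B
    clause c (inj₁ q) with ⋁⁻ (without-var v c) q
    ... | B , m , r = let (m′ , v∉) = ∈-without-var v c m in B , m′ , sat-upd v d B v∉ r
    clause c (inj₂ q) with ⋁⁻ (with-var v c) (q d)
    ... | B , m , r = B , proj₁ (∈-with-var v c m) , r

  toFm-sound : ∀ {ρ} ψ → sat ρ (toFm ψ) → satQF M ρ ψ
  toFm-sound (pos a)  p        = p
  toFm-sound (neg a)  p        = p
  toFm-sound (φ ∧ᶠ ψ) (p , q)  = toFm-sound φ p , toFm-sound ψ q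
  toFm-sound (φ ∨ᶠ ψ) (inj₁ p) = inj₁ (toFm-sound φ p)
  toFm-sound (φ ∨ᶠ ψ) (inj₂ q) = inj₂ (toFm-sound ψ q)

  pushAlls-sound : ∀ vs A ρ → sat ρ (pushAlls vs A) → satAll M vs (λ ρ → sat ρ A) ρ
  pushAlls-sound []       A ρ p   = p
  pushAlls-sound (v ∷ vs) A ρ p d = pushAlls-sound vs A _ (pushAll-sound v (pushAlls vs A) p d)

  pushExs-sound : ∀ vs A ρ → sat ρ (pushExs vs A) → satEx M vs (λ ρ → sat ρ A) ρ
  pushExs-sound []       A ρ p = p
  pushExs-sound (v ∷ vs) A ρ p with pushEx-sound v (pushExs vs A) p
  ... | d , q = d , pushExs-sound vs A _ q

  miniscope-sound : ∀ bs ψ ρ → sat ρ (miniscope bs ψ) → satPrefix M bs ψ ρ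
  miniscope-sound []       ψ ρ p = toFm-sound ψ p
  miniscope-sound (b ∷ bs) ψ ρ p =
    satAll-mono M (xs b) (λ ρ → satEx-mono M (ys b) (miniscope-sound bs ψ) ρ ∘ pushExs-sound (ys b) _ ρ)
      ρ (pushAlls-sound (xs b) _ ρ p)

module _ (M : Structure) where
  open Structure M
  open Classical M

  stable : ∀ {ρ} A → ¬¬ sat ρ A → sat ρ A
  stable (lit true a)  p = λ k → p λ q → q k
  stable (lit false a) p = λ h → p λ q → q h
  stable ⊤ᶠ        p = tt
  stable ⊥ᶠ        p = λ k → p λ q → q k
  stable (A ⩓ B)   p = stable A (λ k → p (k ∘ proj₁)) , stable B (λ k → p (k ∘ proj₂))
  stable (A ⩔ B)   p = λ k → p λ q → q k
  stable (ex v A)  p = λ k → p λ q → q k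
  stable (all v A) p d = stable A λ k → p λ q → k (q d)

  pushEx-complete : ∀ v A {ρ} d → sat (_[_↦_] M ρ v d) A → sat ρ (pushEx v A)
  pushEx-complete v A {ρ} d p = stable (pushEx v A) (dnf-complete A p >>= λ (c , m , h) → return
    (⋁⁺ (∈-map⁺ (exConj v) m)
      ( ⋀⁺ (without-var v c) (λ {B} m → let (m′ , v∉) = ∈-without-var v c m in sat-upd⁻ v d B v∉ (h B m′))
      , return (d , ⋀⁺ (with-var v c) (λ {B} m → h B (proj₁ (∈-with-var v c m)))))))

  -- Here miniscoping is essentially classical: ∀d (P ∨ Q d) has to yield P ∨ ∀d Q d over an
  -- infinite domain. Under the refutation `k` of the goal, no disjunct free of `v` can be true, so
  -- each `d` makes a disjunct containing `v` true, which contradicts `k` after all.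
  pushAll-complete : ∀ v A {ρ} → (∀ d → sat (_[_↦_] M ρ v d) A) → sat ρ (pushAll v A)
  pushAll-complete v A {ρ} p = ⋀⁺ (map (allDisj v) (cnf A)) λ m → clause (∈-map⁻ (allDisj v) m)
    where
    clause : ∀ {B} → (∃ λ c → c ∈ cnf A × B ≡ allDisj v c) → sat ρ B
    clause (c , c∈ , refl) k = k (inj₂ λ d → stable (⋁ (with-var v c)) (cnf-complete A (p d) >>= λ h →
      let (B , B∈ , q) = h c c∈ in
      [ (λ m _ → k (inj₁ (⋁⁺ m (sat-upd⁻ v d B (proj₂ (∈-without-var v c m)) q))))
      , (λ m → return (⋁⁺ m q)) ]′ (∈-split-var v c B∈)))

  toFm-complete : ∀ {ρ} ψ → satQF M ρ ψ → sat ρ (toFm ψ)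
  toFm-complete (pos a)  p        = return p
  toFm-complete (neg a)  p        = p
  toFm-complete (φ ∧ᶠ ψ) (p , q)  = toFm-complete φ p , toFm-complete ψ q
  toFm-complete (φ ∨ᶠ ψ) (inj₁ p) = return (inj₁ (toFm-complete φ p))
  toFm-complete (φ ∨ᶠ ψ) (inj₂ q) = return (inj₂ (toFm-complete ψ q))

  pushAlls-complete : ∀ vs A ρ → satAll M vs (λ ρ → sat ρ A) ρ → sat ρ (pushAlls vs A)
  pushAlls-complete []       A ρ p = p
  pushAlls-complete (v ∷ vs) A ρ p = pushAll-complete v (pushAlls vs A) λ d → pushAlls-complete vs A _ (p d)

  pushExs-complete : ∀ vs A ρ → satEx M vs (λ ρ → sat ρ A) ρ → sat ρ (pushExs vs A)
  pushExs-complete []       A ρ p       = p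
  pushExs-complete (v ∷ vs) A ρ (d , p) = pushEx-complete v (pushExs vs A) d (pushExs-complete vs A _ p)

  miniscope-complete : ∀ bs ψ ρ → satPrefix M bs ψ ρ → sat ρ (miniscope bs ψ)
  miniscope-complete []       ψ ρ p = toFm-complete ψ p
  miniscope-complete (b ∷ bs) ψ ρ p = pushAlls-complete (xs b) _ ρ
    (satAll-mono M (xs b) (λ ρ → pushExs-complete (ys b) _ ρ ∘ satEx-mono M (ys b) (miniscope-complete bs ψ) ρ) ρ p)

-- Miniscoped GAF sentences have no nested universal quantifiers

NoAll : Fm → Set
NoAll (A ⩓ B)   = NoAll A × NoAll B
NoAll (A ⩔ B)   = NoAll A × NoAll B
NoAll (ex v A)  = NoAll A
NoAll (all v A) = ⊥
NoAll _         = ⊤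

NoNestedAll : Fm → Set
NoNestedAll (A ⩓ B)   = NoNestedAll A × NoNestedAll B
NoNestedAll (A ⩔ B)   = NoNestedAll A × NoNestedAll B
NoNestedAll (ex v A)  = NoNestedAll A
NoNestedAll (all v A) = NoAll A
NoNestedAll _         = ⊤

NoAll⇒NoNestedAll : ∀ A → NoAll A → NoNestedAll A
NoAll⇒NoNestedAll (lit b a) n       = tt
NoAll⇒NoNestedAll ⊤ᶠ        n       = tt
NoAll⇒NoNestedAll ⊥ᶠ        n       = tt
NoAll⇒NoNestedAll (A ⩓ B)   (m , n) = NoAll⇒NoNestedAll A m , NoAll⇒NoNestedAll B n
NoAll⇒NoNestedAll (A ⩔ B)   (m , n) = NoAll⇒NoNestedAll A m , NoAll⇒NoNestedAll B n
NoAll⇒NoNestedAll (ex v A)  n       = NoAll⇒NoNestedAll A n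

-- Units of normal forms

IsUnit : Fm → Set
IsUnit (lit b a) = ⊤
IsUnit (ex v A)  = ⊤
IsUnit (all v A) = ⊤
IsUnit _         = ⊥

-- Normal forms rearrange the units but never open them, so an invariant imposed on units alone
-- survives `dnf` and `cnf`.
Units : (Fm → Set) → Fm → Set
Units U ⊤ᶠ      = ⊤
Units U ⊥ᶠ      = ⊤
Units U (A ⩓ B) = Units U A × Units U B
Units U (A ⩔ B) = Units U A × Units U B
Units U A       = U A

module _ {U : Fm → Set} where

  unit : ∀ A → IsUnit A → U A → Units U A
  unit (lit b a) _ u = u
  unit (ex v A)  _ u = u
  unit (all v A) _ u = u

  dnf-units : ∀ A → Units U A → ∀ {c B} → c ∈ dnf A → B ∈ c → IsUnit B × U B
  dnf-units (lit b a) u (here refl) (here refl) = tt , u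
  dnf-units ⊤ᶠ        u (here refl) ()
  dnf-units (A ⩓ B) (u , w) c∈ B∈ with ∈-cartesianProductWith⁻ _++_ (dnf A) (dnf B) c∈
  ... | c₁ , c₂ , m₁ , m₂ , refl = [ dnf-units A u m₁ , dnf-units B w m₂ ]′ (∈-++⁻ c₁ B∈)
  dnf-units (A ⩔ B) (u , w) c∈ B∈ with ∈-++⁻ (dnf A) c∈
  ... | inj₁ m = dnf-units A u m B∈
  ... | inj₂ m = dnf-units B w m B∈
  dnf-units (ex v A)  u (here refl) (here refl) = tt , u
  dnf-units (all v A) u (here refl) (here refl) = tt , u

  cnf-units : ∀ A → Units U A → ∀ {c B} → c ∈ cnf A → B ∈ c → IsUnit B × U B
  cnf-units (lit b a) u (here refl) (here refl) = tt , u
  cnf-units ⊥ᶠ        u (here refl) ()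
  cnf-units (A ⩓ B) (u , w) c∈ B∈ with ∈-++⁻ (cnf A) c∈
  ... | inj₁ m = cnf-units A u m B∈
  ... | inj₂ m = cnf-units B w m B∈
  cnf-units (A ⩔ B) (u , w) c∈ B∈ with ∈-cartesianProductWith⁻ _++_ (cnf A) (cnf B) c∈
  ... | c₁ , c₂ , m₁ , m₂ , refl = [ cnf-units A u m₁ , cnf-units B w m₂ ]′ (∈-++⁻ c₁ B∈)
  cnf-units (ex v A)  u (here refl) (here refl) = tt , u
  cnf-units (all v A) u (here refl) (here refl) = tt , u

  ⋀-units : ∀ c → (∀ {B} → B ∈ c → Units U B) → Units U (⋀ c)
  ⋀-units []      h = tt
  ⋀-units (A ∷ c) h = h (here refl) , ⋀-units c (h ∘ there)

  ⋁-units : ∀ c → (∀ {B} → B ∈ c → Units U B) → Units U (⋁ c)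
  ⋁-units []      h = tt
  ⋁-units (A ∷ c) h = h (here refl) , ⋁-units c (h ∘ there)

FV-⋀ : ∀ c {v} → FV v (⋀ c) → ∃ λ B → B ∈ c × FV v B
FV-⋀ (A ∷ c) (inj₁ p) = A , here refl , p
FV-⋀ (A ∷ c) (inj₂ p) with FV-⋀ c p
... | B , m , q = B , there m , q

FV-⋁ : ∀ c {v} → FV v (⋁ c) → ∃ λ B → B ∈ c × FV v B
FV-⋁ (A ∷ c) (inj₁ p) = A , here refl , p
FV-⋁ (A ∷ c) (inj₂ p) with FV-⋁ c p
... | B , m , q = B , there m , q

NoAll-⋀ : ∀ c → (∀ {B} → B ∈ c → NoAll B) → NoAll (⋀ c)
NoAll-⋀ []      h = tt
NoAll-⋀ (A ∷ c) h = h (here refl) , NoAll-⋀ c (h ∘ there)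

NoAll-⋁ : ∀ c → (∀ {B} → B ∈ c → NoAll B) → NoAll (⋁ c)
NoAll-⋁ []      h = tt
NoAll-⋁ (A ∷ c) h = h (here refl) , NoAll-⋁ c (h ∘ there)

NoNestedAll-⋀ : ∀ c → (∀ {B} → B ∈ c → NoNestedAll B) → NoNestedAll (⋀ c)
NoNestedAll-⋀ []      h = tt
NoNestedAll-⋀ (A ∷ c) h = h (here refl) , NoNestedAll-⋀ c (h ∘ there)

-- Positions of variables in the quantifier prefix

memb-true : ∀ {v} vs → v ∈ vs → memb v vs ≡ true
memb-true {v} (w ∷ vs) (here refl) rewrite ≡ᵇ-refl v = refl
memb-true {v} (w ∷ vs) (there m) with v ≡ᵇ w
... | true  = refl
... | false = memb-true vs m

memb-false : ∀ {v} vs → v ∉ vs → memb v vs ≡ false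
memb-false []           n = refl
memb-false {v} (w ∷ vs) n rewrite ≡ᵇ-false v w (n ∘ here) = memb-false vs (n ∘ there)

blockVars : Block → List Var
blockVars b = xs b ++ ys b

idx-before : ∀ bs {bs′ v} → v ∈ boundVars bs → idx (bs ++ bs′) v < length bs
idx-before (b ∷ bs) {bs′} {v} m with memb v (blockVars b) in eq
... | true = s≤s z≤n
... | false with ∈-++⁻ (blockVars b) m
...   | inj₂ m′ = s≤s (idx-before bs m′)
...   | inj₁ m′ with trans (sym eq) (memb-true (blockVars b) m′)
...     | ()

idx-at : ∀ bs {b bs′ v} → v ∉ boundVars bs → v ∈ blockVars b → idx (bs ++ b ∷ bs′) v ≡ length bs
idx-at [] {b} {v = v} n m rewrite memb-true (blockVars b) m = refl
idx-at (b ∷ bs) {v = v} n m rewrite memb-false (blockVars b) (n ∘ ∈-++⁺ˡ) =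
  cong suc (idx-at bs (n ∘ ∈-++⁺ʳ (blockVars b)) m)

Unique-disjoint : ∀ (us : List Var) {vs v} → Unique (us ++ vs) → v ∈ us → v ∉ vs
Unique-disjoint (u ∷ us) (p ∷ q) (here refl) m′ = All.lookup p (∈-++⁺ʳ us m′) refl
Unique-disjoint (u ∷ us) (p ∷ q) (there m)   m′ = Unique-disjoint us q m m′

Unique-++ʳ : ∀ (us : List Var) {vs} → Unique (us ++ vs) → Unique vs
Unique-++ʳ []       p       = p
Unique-++ʳ (u ∷ us) (_ ∷ p) = Unique-++ʳ us p

Unique-++ˡ : ∀ (us : List Var) {vs} → Unique (us ++ vs) → Unique us
Unique-++ˡ []       p       = []
Unique-++ˡ (u ∷ us) (p ∷ q) = All.tabulate (λ m → All.lookup p (∈-++⁺ˡ m)) ∷ Unique-++ˡ us q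

univ⊆bound : ∀ bs {v} → v ∈ univVars bs → v ∈ boundVars bs
univ⊆bound (b ∷ bs) m with ∈-++⁻ (xs b) m
... | inj₁ p = ∈-++⁺ˡ (∈-++⁺ˡ p)
... | inj₂ p = ∈-++⁺ʳ (blockVars b) (univ⊆bound bs p)

ex⊆bound : ∀ bs {v} → v ∈ exVars bs → v ∈ boundVars bs
ex⊆bound (b ∷ bs) m with ∈-++⁻ (ys b) m
... | inj₁ p = ∈-++⁺ˡ (∈-++⁺ʳ (xs b) p)
... | inj₂ p = ∈-++⁺ʳ (blockVars b) (ex⊆bound bs p)

bound⇒univ⊎ex : ∀ bs {v} → v ∈ boundVars bs → v ∈ univVars bs ⊎ v ∈ exVars bs
bound⇒univ⊎ex (b ∷ bs) m with ∈-++⁻ (blockVars b) m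
... | inj₁ p with ∈-++⁻ (xs b) p
...   | inj₁ q = inj₁ (∈-++⁺ˡ q)
...   | inj₂ q = inj₂ (∈-++⁺ˡ q)
bound⇒univ⊎ex (b ∷ bs) m | inj₂ p with bound⇒univ⊎ex bs p
...   | inj₁ q = inj₁ (∈-++⁺ʳ (xs b) q)
...   | inj₂ q = inj₂ (∈-++⁺ʳ (ys b) q)

univ-ex-disjoint : ∀ bs {v} → Unique (boundVars bs) → v ∈ univVars bs → v ∉ exVars bs
univ-ex-disjoint (b ∷ bs) u m n with ∈-++⁻ (xs b) m | ∈-++⁻ (ys b) n
... | inj₁ p | inj₁ q = Unique-disjoint (xs b) (Unique-++ˡ (blockVars b) u) p q
... | inj₁ p | inj₂ q = Unique-disjoint (blockVars b) u (∈-++⁺ˡ p) (ex⊆bound bs q)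
... | inj₂ p | inj₁ q = Unique-disjoint (blockVars b) u (∈-++⁺ʳ (xs b) q) (univ⊆bound bs p)
... | inj₂ p | inj₂ q = univ-ex-disjoint bs (Unique-++ʳ (blockVars b) u) p q

∈-concatMap-split : ∀ (f : Block → List Var) bs b bs′ {v} → v ∈ concatMap f (bs ++ b ∷ bs′) →
                    v ∈ concatMap f bs ⊎ v ∈ f b ⊎ v ∈ concatMap f bs′
∈-concatMap-split f []        b bs′ m with ∈-++⁻ (f b) m
... | inj₁ p = inj₂ (inj₁ p)
... | inj₂ p = inj₂ (inj₂ p)
∈-concatMap-split f (b₀ ∷ bs) b bs′ m with ∈-++⁻ (f b₀) m
... | inj₁ p = inj₁ (∈-++⁺ˡ p)
... | inj₂ p with ∈-concatMap-split f bs b bs′ p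
...   | inj₁ q = inj₁ (∈-++⁺ʳ (f b₀) q)
...   | inj₂ q = inj₂ q

∈-concatMap-at : ∀ (f : Block → List Var) bs {b bs′ v} → v ∈ f b → v ∈ concatMap f (bs ++ b ∷ bs′)
∈-concatMap-at f []        m = ∈-++⁺ˡ m
∈-concatMap-at f (b₀ ∷ bs) m = ∈-++⁺ʳ (f b₀) (∈-concatMap-at f bs m)

Unique-earlier : ∀ bs {b bs′ v} → Unique (boundVars (bs ++ b ∷ bs′)) → v ∈ blockVars b → v ∉ boundVars bs
Unique-earlier (b₀ ∷ bs) u m n with ∈-++⁻ (blockVars b₀) n
... | inj₁ p = Unique-disjoint (blockVars b₀) u p (∈-concatMap-at blockVars bs m)
... | inj₂ p = Unique-earlier bs (Unique-++ʳ (blockVars b₀) u) m p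

-- The GAF partition during miniscoping

module _ (φ : Sentence) (lab : Atom → Maybe Var) (std : StandardForm φ) (gaf : GAFPartition φ lab) where
  open StandardForm std
  open GAFPartition gaf

  private
    bound : ∀ {v x} → OccIn v x → v ∈ X ⊎ v ∈ Y
    bound (a , a∈ , _ , v∈) = bound⇒univ⊎ex (prefix φ) (closed (∈-concatMap⁺ varsA (lose a∈ v∈)))

    X∌Y : ∀ {v} → v ∈ X → v ∉ Y
    X∌Y = univ-ex-disjoint (prefix φ) boundOnce

  -- The part (At₀ or At_x) a unit belongs to once the variables in post have
  -- been quantified; units that belonged to At_x fall into At₀ after x.
  Part : List Var → Maybe Var → Fm → Set
  Part post (just x) A = x ∈ X × x ∉ post × NoAll A × (∀ v → FV v A → v ∉ post × OccIn v x)
  Part post nothing  A = NoNestedAll A × (∀ v → FV v A → v ∉ post × v ∉ X × ¬ C2 v)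

  InPart : List Var → Fm → Set
  InPart post A = ∃ λ l → Part post l A

  private
    ∉-∷ : ∀ {v w : Var} {post} → v ≢ w → v ∉ post → v ∉ w ∷ post
    ∉-∷ n m (here p)  = n p
    ∉-∷ n m (there p) = m p

  -- Suppose `y` occurs in a unit of a still open At_x. As `x` is not yet quantified, its index is
  -- at most that of `y`, so (c.1) fails and (c.2) confines `y` to this single At_x. Units in At₀
  -- contain no (c.2) variable, so units of the two kinds never meet under ∃y.
  pushEx-part : ∀ {post} y A → y ∈ Y → (∀ {x} → x ∈ X → x ∉ post → ix x ≤ ix y) →
                Units (InPart post) A → Units (InPart (y ∷ post)) (pushEx y A)
  pushEx-part {post} y A y∈Y x≤y u = ⋁-units (map (exConj y) (dnf A)) λ m → conj (∈-map⁻ (exConj y) m)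
    where
    keep : ∀ {B} → ¬ FV y B → InPart post B → InPart (y ∷ post) B
    keep n (just x , x∈ , x∉ , p , h) = just x , x∈ , ∉-∷ (λ { refl → X∌Y x∈ y∈Y }) x∉ , p
      , λ v v∈ → ∉-∷ (λ { refl → n v∈ }) (proj₁ (h v v∈)) , proj₂ (h v v∈)
    keep n (nothing , p , h) = nothing , p
      , λ v v∈ → ∉-∷ (λ { refl → n v∈ }) (proj₁ (h v v∈)) , proj₂ (h v v∈)

    late : ∀ {x B} → Part post (just x) B → FV y B → ∀ {C} → InPart post C → FV y C → Part post (just x) C
    late {x} (x∈ , x∉ , p , h) y∈B {C} (l , q) y∈C with proj₁ (condC y∈Y (proj₂ (h y y∈B)))
    ... | inj₁ c1 = ⊥-elim (<⇒≱ (c1 (proj₂ (h y y∈B))) (x≤y x∈ x∉))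
    ... | inj₂ c2@(x′ , occ , uniq , rest) with l
    ...   | nothing = ⊥-elim (proj₂ (proj₂ (proj₂ q y y∈C)) c2)
    ...   | just x″ = subst (λ z → Part post (just z) C)
                        (trans (uniq (proj₂ (proj₂ (proj₂ (proj₂ q)) y y∈C))) (sym (uniq (proj₂ (h y y∈B))))) q

    quantify : ∀ c → (∀ {B} → B ∈ c → InPart post B × FV y B) → InPart (y ∷ post) (ex y (⋀ c))
    quantify []      h = nothing , tt , λ { v (_ , ()) }
    quantify (B ∷ c) h with h (here refl)
    ... | (just x , q) , y∈ = just x , proj₁ q , ∉-∷ (λ { refl → X∌Y (proj₁ q) y∈Y }) (proj₁ (proj₂ q))
        , NoAll-⋀ (B ∷ c) (λ m → proj₁ (proj₂ (proj₂ (same m))))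
        , λ v (v≢ , v∈) → let (C , m , v∈C) = FV-⋀ (B ∷ c) v∈ ; (v∉ , occ) = proj₂ (proj₂ (proj₂ (same m))) v v∈C
                          in ∉-∷ v≢ v∉ , occ
      where
      same : ∀ {C} → C ∈ B ∷ c → Part post (just x) C
      same {C} m = late {B = B} q y∈ {C} (proj₁ (h m)) (proj₂ (h m))
    ... | (nothing , q) , y∈ = nothing , NoNestedAll-⋀ (B ∷ c) (λ m → proj₁ (same m))
        , λ v (v≢ , v∈) → let (C , m , v∈C) = FV-⋀ (B ∷ c) v∈ ; (v∉ , rest) = proj₂ (same m) v v∈C
                          in ∉-∷ v≢ v∉ , rest
      where
      same : ∀ {C} → C ∈ B ∷ c → Part post nothing C
      same {C} m with h m
      ... | (nothing , r) , _ = r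
      ... | (just x , r) , y∈C with condC y∈Y (proj₂ (proj₂ (proj₂ (proj₂ r)) y y∈C))
      ...   | inj₁ c1 , _ = ⊥-elim (<⇒≱ (c1 (proj₂ (proj₂ (proj₂ (proj₂ r)) y y∈C))) (x≤y (proj₁ r) (proj₁ (proj₂ r))))
      ...   | inj₂ c2 , _ = ⊥-elim (proj₂ (proj₂ (proj₂ q y y∈)) c2)

    conj : ∀ {B} → (∃ λ c → c ∈ dnf A × B ≡ exConj y c) → Units (InPart (y ∷ post)) B
    conj (c , c∈ , refl) =
        ⋀-units (without-var y c) (λ {B} m → let (m′ , n) = ∈-without-var y c m ; (i , p) = dnf-units A u c∈ m′
                                             in unit B i (keep {B} n p))
      , quantify (with-var y c) (λ m → let (m′ , y∈) = ∈-with-var y c m in proj₂ (dnf-units A u c∈ m′) , y∈)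

  -- By (b) the units containing `x` all lie in At_x, so ∀x meets no other ∀. Afterwards they fit
  -- into At₀: what remains free in them is existential by (b), and not of type (c.2), since its
  -- index is below that of `x`.
  pushAll-part : ∀ {post} x A → x ∈ X → (∀ {y} → y ∈ Y → y ∉ post → ix y < ix x) →
                 Units (InPart post) A → Units (InPart (x ∷ post)) (pushAll x A)
  pushAll-part {post} x A x∈X y<x u = ⋀-units (map (allDisj x) (cnf A)) λ m → disj (∈-map⁻ (allDisj x) m)
    where
    discharge : ∀ {v} → v ≢ x → v ∉ post → OccIn v x → v ∉ x ∷ post × v ∉ X × ¬ C2 v
    discharge {v} v≢ v∉ occ@(a , a∈ , la , v∈) = ∉-∷ v≢ v∉ , v∉X , notC2
      where
      v∉X : v ∉ X
      v∉X m = v≢ (condB⊆ a∈ la v∈ m)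
      notC2 : ¬ C2 v
      notC2 (x′ , occ′ , uniq , _ , x′≤v) with bound occ
      ... | inj₁ m = v∉X m
      ... | inj₂ m = <⇒≱ (y<x m v∉) (subst (λ z → ix z ≤ ix v) (sym (uniq occ)) x′≤v)

    keep : ∀ {B} → ¬ FV x B → InPart post B → InPart (x ∷ post) B
    keep {B} n (just x′ , x∈ , x∉ , p , h) with x′ ≟ x
    -- A unit of At_x in which `x` is absent must move to At₀ too, since `x` now counts as
    -- quantified.
    ... | yes refl = nothing , NoAll⇒NoNestedAll B p
        , λ v v∈ → discharge (λ { refl → n v∈ }) (proj₁ (h v v∈)) (proj₂ (h v v∈))
    ... | no x≢ = just x′ , x∈ , ∉-∷ x≢ x∉ , p
        , λ v v∈ → ∉-∷ (λ { refl → n v∈ }) (proj₁ (h v v∈)) , proj₂ (h v v∈)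
    keep n (nothing , p , h) = nothing , p
      , λ v v∈ → ∉-∷ (λ { refl → n v∈ }) (proj₁ (h v v∈)) , proj₂ (h v v∈)

    same : ∀ {B} → InPart post B → FV x B → Part post (just x) B
    same (nothing , p , h) x∈ = ⊥-elim (proj₁ (proj₂ (h x x∈)) x∈X)
    same {B} (just x′ , q) x∈ with proj₂ (proj₂ (proj₂ (proj₂ q)) x x∈)
    ... | a , a∈ , la , v∈ = subst (λ z → Part post (just z) B) (sym (condB⊆ a∈ la v∈ x∈X)) q

    quantify : ∀ c → (∀ {B} → B ∈ c → InPart post B × FV x B) → InPart (x ∷ post) (all x (⋁ c))
    quantify c h = nothing , NoAll-⋁ c (λ m → proj₁ (proj₂ (proj₂ (same′ m))))
      , λ v (v≢ , v∈) → let (C , m , v∈C) = FV-⋁ c v∈ ; (v∉ , occ) = proj₂ (proj₂ (proj₂ (same′ m))) v v∈C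
                        in discharge v≢ v∉ occ
      where
      same′ : ∀ {B} → B ∈ c → Part post (just x) B
      same′ {B} m = same {B} (proj₁ (h m)) (proj₂ (h m))

    disj : ∀ {B} → (∃ λ c → c ∈ cnf A × B ≡ allDisj x c) → Units (InPart (x ∷ post)) B
    disj (c , c∈ , refl) =
        ⋁-units (without-var x c) (λ {B} m → let (m′ , n) = ∈-without-var x c m ; (i , p) = cnf-units A u c∈ m′
                                             in unit B i (keep {B} n p))
      , quantify (with-var x c) (λ m → let (m′ , x∈) = ∈-with-var x c m in proj₂ (cnf-units A u c∈ m′) , x∈)

  pushExs-part : ∀ {post} vs A → (∀ {y} → y ∈ vs → y ∈ Y × (∀ {x} → x ∈ X → x ∉ post → ix x ≤ ix y)) →
                 Units (InPart post) A → Units (InPart (vs ++ post)) (pushExs vs A)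
  pushExs-part []       A h u = u
  pushExs-part (y ∷ vs) A h u =
    pushEx-part y (pushExs vs A) (proj₁ (h (here refl))) (λ x∈ x∉ → proj₂ (h (here refl)) x∈ (x∉ ∘ ∈-++⁺ʳ vs))
      (pushExs-part vs A (h ∘ there) u)

  pushAlls-part : ∀ {post} vs A → (∀ {x} → x ∈ vs → x ∈ X × (∀ {y} → y ∈ Y → y ∉ post → ix y < ix x)) →
                  Units (InPart post) A → Units (InPart (vs ++ post)) (pushAlls vs A)
  pushAlls-part []       A h u = u
  pushAlls-part (x ∷ vs) A h u =
    pushAll-part x (pushAlls vs A) (proj₁ (h (here refl))) (λ y∈ y∉ → proj₂ (h (here refl)) y∈ (y∉ ∘ ∈-++⁺ʳ vs))
      (pushAlls-part vs A (h ∘ there) u)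

  private
    lit-part : ∀ b {a} → a ∈ At → InPart [] (lit b a)
    lit-part b {a} a∈ with lab a in eq
    ... | just x  = just x , labels a∈ eq , (λ ()) , tt , λ v v∈ → (λ ()) , a , a∈ , eq , v∈
    ... | nothing = nothing , tt , λ v v∈ → (λ ()) , condA a∈ eq v∈ , λ (_ , _ , _ , n , _) → n a∈ eq v∈

  toFm-part : ∀ ψ → (∀ {a} → a ∈ atoms ψ → a ∈ At) → Units (InPart []) (toFm ψ)
  toFm-part (pos a)  h = lit-part true (h (here refl))
  toFm-part (neg a)  h = lit-part false (h (here refl))
  toFm-part (ψ ∧ᶠ χ) h = toFm-part ψ (h ∘ ∈-++⁺ˡ) , toFm-part χ (h ∘ ∈-++⁺ʳ (atoms ψ))
  toFm-part (ψ ∨ᶠ χ) h = toFm-part ψ (h ∘ ∈-++⁺ˡ) , toFm-part χ (h ∘ ∈-++⁺ʳ (atoms ψ))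

  -- When the existentials of `b` are pushed, the remaining universals lie in `bs` or in `b` itself,
  -- which gives ≤ between indices; when its universals are pushed, the remaining existentials lie
  -- in `bs`, which gives <. These are the two sides of condition (c).
  miniscope-part : ∀ bs bs′ → bs ++ bs′ ≡ prefix φ →
                   Units (InPart (boundVars bs′)) (miniscope bs′ (matrix φ))
  miniscope-part bs []        eq = toFm-part (matrix φ) id
  miniscope-part bs (b ∷ bs′) eq = subst (λ z → Units (InPart z) (miniscope (b ∷ bs′) (matrix φ)))
      (sym (++-assoc (xs b) (ys b) (boundVars bs′)))
      (pushAlls-part (xs b) _ univ (pushExs-part (ys b) _ exis
        (miniscope-part (bs ++ b ∷ []) bs′ (trans (++-assoc bs (b ∷ []) bs′) eq))))
    where
    unique : Unique (boundVars (bs ++ b ∷ bs′))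
    unique = subst (Unique ∘ boundVars) (sym eq) boundOnce

    ix-at : ∀ {v} → v ∈ blockVars b → ix v ≡ length bs
    ix-at {v} m = trans (cong (λ z → idx z v) (sym eq)) (idx-at bs (Unique-earlier bs unique m) m)

    ix-before : ∀ {v} → v ∈ boundVars bs → ix v < length bs
    ix-before {v} m = subst (λ z → idx z v < length bs) eq (idx-before bs m)

    univ : ∀ {x} → x ∈ xs b → x ∈ X × (∀ {y} → y ∈ Y → y ∉ ys b ++ boundVars bs′ → ix y < ix x)
    univ {x} x∈ = subst (λ z → x ∈ univVars z) eq (∈-concatMap-at xs bs x∈) , before
      where
      before : ∀ {y} → y ∈ Y → y ∉ ys b ++ boundVars bs′ → ix y < ix x
      before {y} y∈ y∉ with ∈-concatMap-split ys bs b bs′ (subst (λ z → y ∈ exVars z) (sym eq) y∈)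
      ... | inj₁ m        = subst (ix y <_) (sym (ix-at (∈-++⁺ˡ x∈))) (ix-before (ex⊆bound bs m))
      ... | inj₂ (inj₁ m) = ⊥-elim (y∉ (∈-++⁺ˡ m))
      ... | inj₂ (inj₂ m) = ⊥-elim (y∉ (∈-++⁺ʳ (ys b) (ex⊆bound bs′ m)))

    exis : ∀ {y} → y ∈ ys b → y ∈ Y × (∀ {x} → x ∈ X → x ∉ boundVars bs′ → ix x ≤ ix y)
    exis {y} y∈ = subst (λ z → y ∈ exVars z) eq (∈-concatMap-at ys bs y∈) , before
      where
      y-at : ix y ≡ length bs
      y-at = ix-at (∈-++⁺ʳ (xs b) y∈)
      before : ∀ {x} → x ∈ X → x ∉ boundVars bs′ → ix x ≤ ix y
      before {x} x∈ x∉ with ∈-concatMap-split xs bs b bs′ (subst (λ z → x ∈ univVars z) (sym eq) x∈)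
      ... | inj₁ m        = subst (ix x ≤_) (sym y-at) (<⇒≤ (ix-before (univ⊆bound bs m)))
      ... | inj₂ (inj₁ m) = ≤-reflexive (trans (ix-at (∈-++⁺ˡ m)) (sym y-at))
      ... | inj₂ (inj₂ m) = ⊥-elim (x∉ (univ⊆bound bs′ m))

  Units⇒NoNestedAll : ∀ {post} A → Units (InPart post) A → NoNestedAll A
  Units⇒NoNestedAll (lit b a) u = tt
  Units⇒NoNestedAll ⊤ᶠ        u = tt
  Units⇒NoNestedAll ⊥ᶠ        u = tt
  Units⇒NoNestedAll (A ⩓ B)   (u , w) = Units⇒NoNestedAll A u , Units⇒NoNestedAll B w
  Units⇒NoNestedAll (A ⩔ B)   (u , w) = Units⇒NoNestedAll A u , Units⇒NoNestedAll B w
  Units⇒NoNestedAll (ex v A)  (just x , _ , _ , n , _) = NoAll⇒NoNestedAll A n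
  Units⇒NoNestedAll (ex v A)  (nothing , n , _)        = n
  Units⇒NoNestedAll (all v A) (nothing , n , _)        = n

  miniscope-flat : NoNestedAll (miniscope (prefix φ) (matrix φ))
  miniscope-flat = Units⇒NoNestedAll (miniscope (prefix φ) (matrix φ)) (miniscope-part [] (prefix φ) refl)

-- Finite searches

¬¬-all : ∀ {A : Set} {P : A → Set} as → (∀ {a} → a ∈ as → ¬¬ P a) → ¬¬ All P as
¬¬-all []       h = return []
¬¬-all (a ∷ as) h = h (here refl) >>= λ p → ¬¬-all as (h ∘ there) >>= λ ps → return (p ∷ ps)

tuples : ∀ {A : Set} → ℕ → List A → List (List A)
tuples zero    U = [] ∷ []
tuples (suc n) U = cartesianProductWith _∷_ U (tuples n U)

tuples⁺ : ∀ {A : Set} {U : List A} as → All (_∈ U) as → as ∈ tuples (length as) U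
tuples⁺ []       []       = here refl
tuples⁺ (a ∷ as) (m ∷ ms) = ∈-cartesianProductWith⁺ _∷_ m (tuples⁺ as ms)

tuples⁻ : ∀ {A : Set} n (U : List A) {as} → as ∈ tuples n U → All (_∈ U) as × length as ≡ n
tuples⁻ zero    U (here refl) = [] , refl
tuples⁻ (suc n) U m with ∈-cartesianProductWith⁻ _∷_ U (tuples n U) m
... | a , as , a∈ , as∈ , refl = let (p , q) = tuples⁻ n U as∈ in a∈ ∷ p , cong suc q

sublists : ∀ {A : Set} → List A → List (List A)
sublists []       = [] ∷ []
sublists (a ∷ as) = map (a ∷_) (sublists as) ++ sublists as

-- `P` may be undecidable, but under ¬¬ excluded middle can be invoked once for each of the finitely
-- many elements.
comprehension : ∀ {A : Set} (P : A → Set) as →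
                ¬¬ ∃ λ bs → bs ∈ sublists as × (∀ b → b ∈ bs → P b) × (∀ b → b ∈ as → P b → b ∈ bs)
comprehension P []       = return ([] , here refl , (λ _ ()) , λ _ ())
comprehension P (a ∷ as) = comprehension P as >>= λ (bs , bs∈ , s , c) → ¬¬-excluded-middle {A = P a} >>= λ where
  (yes p) → return (a ∷ bs , ∈-++⁺ˡ (∈-map⁺ (a ∷_) bs∈)
                   , (λ { _ (here refl) → p ; b (there m) → s b m })
                   , (λ { _ (here refl) _ → here refl ; b (there m) q → there (c b m q) }))
  (no ¬p) → return (bs , ∈-++⁺ʳ (map (a ∷_) (sublists as)) bs∈ , s
                   , (λ { _ (here refl) q → ⊥-elim (¬p q) ; b (there m) q → c b m q }))

_reflects_on_ : ∀ {A : Set} → (A → Bool) → (A → Set) → List A → Set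
f reflects P on as = ∀ {a} → a ∈ as → (f a ≡ true → P a) × (P a → f a ≡ true)

reflects-≡ : ∀ {P Q : Set} {b c : Bool} → (b ≡ true → P) × (P → b ≡ true) → (c ≡ true → Q) × (Q → c ≡ true) →
             (P → Q) → (Q → P) → b ≡ c
reflects-≡ {b = true}  {c = true}  _ _ _ _ = refl
reflects-≡ {b = false} {c = false} _ _ _ _ = refl
reflects-≡ {b = true}  {c = false} (h , _) (_ , k) f _ = sym (k (f (h refl)))
reflects-≡ {b = false} {c = true}  (_ , h) (k , _) _ g = h (g (k refl))

module Functions {A : Set} (_≟ᴬ_ : DecidableEquality A) where

  override : A → Bool → (A → Bool) → A → Bool
  override a b f x with x ≟ᴬ a
  ... | yes _ = b
  ... | no _  = f x

  functions : List A → List (A → Bool)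
  functions []       = (λ _ → false) ∷ []
  functions (a ∷ as) = cartesianProductWith (override a) (true ∷ false ∷ []) (functions as)

  functions-complete : ∀ (P : A → Set) as → ¬¬ ∃ λ f → f ∈ functions as × f reflects P on as
  functions-complete P []       = return (_ , here refl , λ ())
  functions-complete P (a ∷ as) = functions-complete P as >>= λ (f , f∈ , r) → ¬¬-excluded-middle {A = P a} >>= λ where
      (yes p) → return (override a true f , ∈-cartesianProductWith⁺ (override a) {xs = true ∷ false ∷ []} (here refl) f∈
                       , λ {x} → reflect true f r ((λ _ → p) , (λ _ → refl)))
      (no ¬p) → return (override a false f , ∈-cartesianProductWith⁺ (override a) {xs = true ∷ false ∷ []} (there (here refl)) f∈
                       , λ {x} → reflect false f r ((λ ()) , ⊥-elim ∘ ¬p))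
    where
    reflect : ∀ b f → f reflects P on as → (b ≡ true → P a) × (P a → b ≡ true) →
              override a b f reflects P on (a ∷ as)
    reflect b f r h {x} m with x ≟ᴬ a | m
    ... | yes refl | _          = h
    ... | no x≢a   | here x≡a   = ⊥-elim (x≢a x≡a)
    ... | no _     | there x∈as = r x∈as

-- Boolean constraints on one node of a tree

data Constraint (A : Set) : Set where
  litᶜ      : Bool → A → Constraint A
  ⊤ᶜ ⊥ᶜ     : Constraint A
  _∧ᶜ_ _∨ᶜ_ : Constraint A → Constraint A → Constraint A

module _ {A : Set} where

  Holds : (A → Set) → Constraint A → Set
  Holds P (litᶜ true a)  = P a
  Holds P (litᶜ false a) = ¬ P a
  Holds P ⊤ᶜ             = ⊤
  Holds P ⊥ᶜ             = ⊥
  Holds P (χ ∧ᶜ ξ)       = Holds P χ × Holds P ξ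
  Holds P (χ ∨ᶜ ξ)       = Holds P χ ⊎ Holds P ξ

  holds? : ∀ {P} → (∀ a → Dec (P a)) → ∀ χ → Dec (Holds P χ)
  holds? P? (litᶜ true a)  = P? a
  holds? P? (litᶜ false a) = ¬? (P? a)
  holds? P? ⊤ᶜ             = yes tt
  holds? P? ⊥ᶜ             = no λ ()
  holds? P? (χ ∧ᶜ ξ)       = holds? P? χ ×-dec holds? P? ξ
  holds? P? (χ ∨ᶜ ξ)       = holds? P? χ ⊎-dec holds? P? ξ

  literals : Constraint A → List A
  literals (litᶜ b a) = a ∷ []
  literals (χ ∧ᶜ ξ)   = literals χ ++ literals ξ
  literals (χ ∨ᶜ ξ)   = literals χ ++ literals ξ
  literals _          = []

  holds-map : ∀ {P Q : A → Set} χ → (∀ {a} → a ∈ literals χ → (P a → Q a) × (Q a → P a)) → Holds P χ → Holds Q χ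
  holds-map (litᶜ true a)  h p = proj₁ (h (here refl)) p
  holds-map (litᶜ false a) h n = n ∘ proj₂ (h (here refl))
  holds-map ⊤ᶜ             h p = p
  holds-map (χ ∧ᶜ ξ)       h (p , q) = holds-map χ (h ∘ ∈-++⁺ˡ) p , holds-map ξ (h ∘ ∈-++⁺ʳ (literals χ)) q
  holds-map (χ ∨ᶜ ξ)       h (inj₁ p) = inj₁ (holds-map χ (h ∘ ∈-++⁺ˡ) p)
  holds-map (χ ∨ᶜ ξ)       h (inj₂ q) = inj₂ (holds-map ξ (h ∘ ∈-++⁺ʳ (literals χ)) q)

-- The tree of words, windows and types

module Paths (Sym : Set) (_≟ˢ_ : DecidableEquality Sym) (syms : List Sym) (complete : ∀ s → s ∈ syms) where

  Word : Set
  Word = List Sym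

  -- abs w is the node w itself, loc w the node reached by w from the current one.
  data Slot : Set where
    abs loc : Word → Slot

  Scheme : Set
  Scheme = ℕ × List Slot

  inst : Word → Slot → Word
  inst t (abs w) = w
  inst t (loc w) = t ++ w

  instances : Word → Scheme → ℕ × List Word
  instances t (p , as) = p , map (inst t) as

  -- Change of viewpoint: a slot seen from `t ++ v` becomes the slot for the same word seen from the
  -- ancestor `t`; see `inst-++`.
  shift : Word → Slot → Slot
  shift v (abs w) = abs w
  shift v (loc w) = loc (v ++ w)

  shifts : Word → Scheme → Scheme
  shifts v (p , as) = p , map (shift v) as

  -- Passes from a node to its child. `loc []` names the node left behind and has no address at the
  -- child; its image is a dummy.
  unshift : Slot → Slot
  unshift (abs w)       = abs w
  unshift (loc [])      = loc []
  unshift (loc (s ∷ w)) = loc w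

  size : Slot → ℕ
  size (abs w) = length w
  size (loc w) = length w

  _≟ᵂ_ : DecidableEquality Word
  _≟ᵂ_ = List.≡-dec _≟ˢ_

  _≟ᴸ_ : DecidableEquality Slot
  abs v ≟ᴸ abs w with v ≟ᵂ w
  ... | yes refl = yes refl
  ... | no n     = no λ { refl → n refl }
  abs v ≟ᴸ loc w = no λ ()
  loc v ≟ᴸ abs w = no λ ()
  loc v ≟ᴸ loc w with v ≟ᵂ w
  ... | yes refl = yes refl
  ... | no n     = no λ { refl → n refl }

  _≟ᴱ_ : DecidableEquality Scheme
  _≟ᴱ_ = Product.≡-dec _≟_ (List.≡-dec _≟ᴸ_)

  words≤ : ℕ → List Word
  words≤ zero    = [] ∷ []
  words≤ (suc n) = [] ∷ cartesianProductWith _∷_ syms (words≤ n)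

  words≤⁺ : ∀ n w → length w ≤ n → w ∈ words≤ n
  words≤⁺ zero    []      _       = here refl
  words≤⁺ (suc n) []      _       = here refl
  words≤⁺ (suc n) (s ∷ w) (s≤s l) = there (∈-cartesianProductWith⁺ _∷_ (complete s) (words≤⁺ n w l))

  words≤⁻ : ∀ n {w} → w ∈ words≤ n → length w ≤ n
  words≤⁻ zero    (here refl) = z≤n
  words≤⁻ (suc n) (here refl) = z≤n
  words≤⁻ (suc n) (there m) with ∈-cartesianProductWith⁻ _∷_ syms (words≤ n) m
  ... | s , w , _ , w∈ , refl = s≤s (words≤⁻ n w∈)

  slots : ℕ → List Slot
  slots n = map abs (words≤ n) ++ map loc (words≤ n)

  slots⁺ : ∀ n a → size a ≤ n → a ∈ slots n
  slots⁺ n (abs w) l = ∈-++⁺ˡ (∈-map⁺ abs (words≤⁺ n w l))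
  slots⁺ n (loc w) l = ∈-++⁺ʳ (map abs (words≤ n)) (∈-map⁺ loc (words≤⁺ n w l))

  slots⁻ : ∀ n {a} → a ∈ slots n → size a ≤ n
  slots⁻ n m with ∈-++⁻ (map abs (words≤ n)) m
  ... | inj₁ p with ∈-map⁻ abs p
  ...   | w , w∈ , refl = words≤⁻ n w∈
  slots⁻ n m | inj₂ p with ∈-map⁻ loc p
  ...   | w , w∈ , refl = words≤⁻ n w∈

  module Problem (χ : Constraint Scheme) where

    totalSize : List Slot → ℕ
    totalSize = foldr (λ a n → size a + n) 0

    -- The sum bounds every slot of `χ`. Starting at 1 guarantees that the children of a node, where
    -- constants and Skolem witnesses sit, lie in its window.
    k : ℕ
    k = foldr (λ σ n → totalSize (proj₂ σ) + n) 1 (literals χ)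

    1≤k : 1 ≤ k
    1≤k = base (literals χ)
      where
      base : ∀ σs → 1 ≤ foldr (λ σ n → totalSize (proj₂ σ) + n) 1 σs
      base []       = ≤-refl
      base (σ ∷ σs) = ≤-trans (base σs) (m≤n+m _ _)

    -- The greatest depth visible in the window of a node of depth k + 1, the shallowest depth at
    -- which types are used.
    L : ℕ
    L = suc k + k

    predicates : List (ℕ × ℕ)
    predicates = map (λ σ → proj₁ σ , length (proj₂ σ)) (literals χ)

    atomsOver : ∀ {A : Set} → List A → List (ℕ × List A)
    atomsOver U = concatMap (λ (p , n) → map (p ,_) (tuples n U)) predicates

    atomsOver⁺ : ∀ {A : Set} {U : List A} p as → (p , length as) ∈ predicates → All (_∈ U) as → (p , as) ∈ atomsOver U
    atomsOver⁺ p as m h = ∈-concatMap⁺ _ (lose m (∈-map⁺ (p ,_) (tuples⁺ as h)))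

    atomsOver⁻ : ∀ {A : Set} (U : List A) {p as} → (p , as) ∈ atomsOver U → (p , length as) ∈ predicates × All (_∈ U) as
    atomsOver⁻ U m with find (∈-concatMap⁻ (λ (p , n) → map (p ,_) (tuples n U)) {xs = predicates} m)
    ... | (p , n) , m₁ , m₂ with ∈-map⁻ (p ,_) m₂
    ...   | as , as∈ , refl with tuples⁻ n U as∈
    ...     | h , refl = m₁ , h

    -- Types record more than the literals of `χ`, because neighbouring types have to agree on every
    -- atom in the overlap of their windows.
    schemes : List Scheme
    schemes = atomsOver (slots k)

    schemes⁺ : ∀ p as → (p , length as) ∈ predicates → (∀ {a} → a ∈ as → size a ≤ k) → (p , as) ∈ schemes
    schemes⁺ p as m h = atomsOver⁺ p as m (All.tabulate λ {a} a∈ → slots⁺ k a (h a∈))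

    schemes⁻ : ∀ {p as} → (p , as) ∈ schemes → (p , length as) ∈ predicates × (∀ {a} → a ∈ as → size a ≤ k)
    schemes⁻ m = let (q , h) = atomsOver⁻ (slots k) m in q , λ a∈ → slots⁻ k (All.lookup h a∈)

    groundAtoms : List (ℕ × List Word)
    groundAtoms = atomsOver (words≤ L)

    private
      totalSize≥ : ∀ as {a} → a ∈ as → size a ≤ totalSize as
      totalSize≥ (a ∷ as) (here refl) = m≤m+n _ _
      totalSize≥ (b ∷ as) (there m)   = ≤-trans (totalSize≥ as m) (m≤n+m _ _)

      sum≥ : ∀ σs {σ : Scheme} → σ ∈ σs → totalSize (proj₂ σ) ≤ foldr (λ σ n → totalSize (proj₂ σ) + n) 1 σs
      sum≥ (σ ∷ σs) (here refl) = m≤m+n _ _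
      sum≥ (τ ∷ σs) (there m)   = ≤-trans (sum≥ σs m) (m≤n+m _ _)

    literals⊆schemes : ∀ {σ} → σ ∈ literals χ → σ ∈ schemes
    literals⊆schemes {p , as} m = schemes⁺ p as (∈-map⁺ _ m) λ a∈ → ≤-trans (totalSize≥ as a∈) (sum≥ (literals χ) m)

    size-inst : ∀ t a → length t ≤ suc k → size a ≤ k → length (inst t a) ≤ L
    size-inst t (abs w) l h = ≤-trans h (m≤n+m k (suc k))
    size-inst t (loc w) l h rewrite length-++ t {w} = +-mono-≤ l h

    instances-ground : ∀ t σ → length t ≤ suc k → σ ∈ schemes → instances t σ ∈ groundAtoms
    instances-ground t (p , as) l m = let (q , h) = schemes⁻ m in
      atomsOver⁺ p (map (inst t) as) (subst (λ n → (p , n) ∈ predicates) (sym (length-map (inst t) as)) q)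
        (All.tabulate λ b∈ → let (a , a∈ , eq) = ∈-map⁻ (inst t) b∈ in
          subst (_∈ words≤ L) (sym eq) (words≤⁺ L (inst t a) (size-inst t a l (h a∈))))

    Type : Set
    Type = Scheme → Bool

    -- Agreement on the overlap of the windows of a node and its child. A scheme without local slots
    -- equals its shift, so its value is constant along a branch.
    Successor : Sym → Type → Type → Set
    Successor s A B = All (λ σ → shifts (s ∷ []) σ ∈ schemes → B σ ≡ A (shifts (s ∷ []) σ)) schemes

    Starts : (ℕ × List Word → Bool) → Word → Type → Set
    Starts G t A = All (λ σ → A σ ≡ G (instances t σ)) schemes

    -- G decides the atoms over nodes of depth ≤ 2k+1, and T is a set of
    -- types for the nodes of depth > k.
    Consistent : (ℕ × List Word → Bool) → List Type → Set
    Consistent G T = All (λ t → Holds (λ σ → G (instances t σ) ≡ true) χ) (words≤ k)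
                   × All (λ A → Holds (λ σ → A σ ≡ true) χ) T
                   × All (λ A → All (λ s → Any (Successor s A) T) syms) T
                   × All (λ t → Any (Starts G t) T) (tuples (suc k) syms)

    open Functions _≟ᴱ_ using (functions; functions-complete)
    module Ground = Functions (Product.≡-dec _≟_ (List.≡-dec _≟ᵂ_))
    open DecMembership _≟ᴱ_ using (_∈?_)

    Certificate : Set
    Certificate = Any (λ G → Any (Consistent G) (sublists (functions schemes))) (Ground.functions groundAtoms)

    certificate? : Dec Certificate
    certificate? = Any.any? (λ G → Any.any? (λ T →
            All.all? (λ t → holds? (λ σ → G (instances t σ) Bool.≟ true) χ) (words≤ k)
      ×-dec All.all? (λ A → holds? (λ σ → A σ Bool.≟ true) χ) T
      ×-dec All.all? (λ A → All.all? (λ s → Any.any? (λ B → All.all? (λ σ →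
              (shifts (s ∷ []) σ ∈? schemes) →-dec (B σ Bool.≟ A (shifts (s ∷ []) σ))) schemes) T) syms) T
      ×-dec All.all? (λ t → Any.any? (λ A → All.all? (λ σ → A σ Bool.≟ G (instances t σ)) schemes) T)
              (tuples (suc k) syms))
      (sublists (functions schemes))) (Ground.functions groundAtoms)

    private
      shift-∘ : ∀ s v a → shift (s ∷ v) a ≡ shift (s ∷ []) (shift v a)
      shift-∘ s v (abs w) = refl
      shift-∘ s v (loc w) = refl

      shifts-∘ : ∀ s v σ → shifts (s ∷ v) σ ≡ shifts (s ∷ []) (shifts v σ)
      shifts-∘ s v (p , as) = cong (p ,_) (trans (map-cong (shift-∘ s v) as) (map-∘ as))

      unshift-shift : ∀ s v a → unshift (shift (s ∷ v) a) ≡ shift v a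
      unshift-shift s v (abs w) = refl
      unshift-shift s v (loc w) = refl

      unshifts-shifts : ∀ s v as → map unshift (map (shift (s ∷ v)) as) ≡ map (shift v) as
      unshifts-shifts s v as = trans (sym (map-∘ as)) (map-cong (unshift-shift s v) as)

      shift-[] : ∀ a → shift [] a ≡ a
      shift-[] (abs w) = refl
      shift-[] (loc w) = refl

      shifts-[] : ∀ σ → shifts [] σ ≡ σ
      shifts-[] (p , as) = cong (p ,_) (trans (map-cong shift-[] as) (map-id as))

      inst-++ : ∀ t v a → inst (t ++ v) a ≡ inst t (shift v a)
      inst-++ t v (abs w) = refl
      inst-++ t v (loc w) = ++-assoc t v w

      instances-++ : ∀ t v σ → instances (t ++ v) σ ≡ instances t (shifts v σ)
      instances-++ t v (p , as) = cong (p ,_) (trans (map-cong (inst-++ t v) as) (map-∘ as))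

      size-shift : ∀ s v a → size (shift v a) ≤ size (shift (s ∷ v) a)
      size-shift s v (abs w) = ≤-refl
      size-shift s v (loc w) = n≤1+n _

      -- An atom that fits the window of an ancestor fits every window on the way down to the node
      -- from which it is `σ`. This is what lets its value be transported step by step.
      shifts-tail : ∀ s v σ → shifts (s ∷ v) σ ∈ schemes → shifts v σ ∈ schemes
      shifts-tail s v (p , as) m = let (q , h) = schemes⁻ m in
        schemes⁺ p (map (shift v) as)
          (subst (λ n → (p , n) ∈ predicates) (trans (length-map (shift (s ∷ v)) as) (sym (length-map (shift v) as))) q)
          (λ b∈ → let (a , a∈ , eq) = ∈-map⁻ (shift v) b∈ in
            subst (λ b → size b ≤ k) (sym eq) (≤-trans (size-shift s v a) (h (∈-map⁺ (shift (s ∷ v)) a∈))))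

      take-++ : ∀ (t w : Word) → take (length t) (t ++ w) ≡ t
      take-++ []      w = refl
      take-++ (s ∷ t) w = cong (s ∷_) (take-++ t w)

      drop-++ : ∀ (t w : Word) → drop (length t) (t ++ w) ≡ w
      drop-++ []      w = refl
      drop-++ (s ∷ t) w = drop-++ t w

      take-prefix : ∀ t v w → length t ≡ suc k → take (suc k) ((t ++ v) ++ w) ≡ t
      take-prefix t v w l = trans (cong (take (suc k)) (++-assoc t v w))
                           (trans (cong (λ n → take n (t ++ v ++ w)) (sym l)) (take-++ t (v ++ w)))

      drop-prefix : ∀ t v w → length t ≡ suc k → drop (suc k) ((t ++ v) ++ w) ≡ v ++ w
      drop-prefix t v w l = trans (cong (drop (suc k)) (++-assoc t v w))
                           (trans (cong (λ n → drop n (t ++ v ++ w)) (sym l)) (drop-++ t (v ++ w)))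

    -- A tree model from a certificate: types are chosen along each branch, and an
    -- atom is read off at the first node of the branch whose window contains it.
    module Model {G : ℕ × List Word → Bool} {T : List Type} (cons : Consistent G T) where

      State : Set
      State = Σ Type (_∈ T)

      private
        successor : ∀ s (S : State) → Any (Successor s (proj₁ S)) T
        successor s (A , A∈) = All.lookup (All.lookup (proj₁ (proj₂ (proj₂ cons))) A∈) (complete s)

        starting : ∀ t → length t ≡ suc k → Any (Starts G t) T
        starting t l = All.lookup (proj₂ (proj₂ (proj₂ cons)))
          (subst (λ n → t ∈ tuples n syms) l (tuples⁺ t (All.tabulate λ {s} _ → complete s)))

      next : Sym → State → State
      next s S = let (B , B∈ , _) = find (successor s S) in B , B∈

      next-type : ∀ s S {σ} → σ ∈ schemes → shifts (s ∷ []) σ ∈ schemes →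
                  proj₁ (next s S) σ ≡ proj₁ S (shifts (s ∷ []) σ)
      next-type s S m = let (_ , _ , h) = find (successor s S) in All.lookup h m

      start : ∀ t → length t ≡ suc k → State
      start t l = let (A , A∈ , _) = find (starting t l) in A , A∈

      start-type : ∀ t l {σ} → σ ∈ schemes → proj₁ (start t l) σ ≡ G (instances t σ)
      start-type t l m = let (_ , _ , h) = find (starting t l) in All.lookup h m

      run : State → Word → State
      run S []      = S
      run S (s ∷ v) = run (next s S) v

      -- The state belongs to the current node, the scheme is the atom seen from there, and the word
      -- is the path still ahead. At the end of the path an atom that never fitted gets an arbitrary
      -- value.
      value : State → Scheme → Word → Bool
      value S σ []      = proj₁ S σ
      value S σ (s ∷ v) with σ ∈? schemes
      ... | yes _ = proj₁ S σ
      ... | no _  = value (next s S) (proj₁ σ , map unshift (proj₂ σ)) v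

      value-fits : ∀ S σ v → σ ∈ schemes → value S σ v ≡ proj₁ S σ
      value-fits S σ []      m = refl
      value-fits S σ (s ∷ v) m with σ ∈? schemes
      ... | yes _ = refl
      ... | no n  = ⊥-elim (n m)

      -- Until the atom fits, reading it steps down along `v`; once it fits, the successor condition
      -- carries its value unchanged to the end of `v`. The remainder `x` allows the path to be that
      -- of an argument lying below this node.
      value-run : ∀ S v x {σ} → σ ∈ schemes → value S (shifts v σ) (v ++ x) ≡ proj₁ (run S v) σ
      value-run S []      x {σ} m = trans (cong (λ τ → value S τ x) (shifts-[] σ)) (value-fits S σ x m)
      value-run S (s ∷ v) x {σ} m with shifts (s ∷ v) σ ∈? schemes
      ... | yes m′ = trans (cong (proj₁ S) (shifts-∘ s v σ))
                    (trans (sym (next-type s S (shifts-tail s v σ m′) (subst (_∈ schemes) (shifts-∘ s v σ) m′)))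
                    (trans (sym (value-fits (next s S) (shifts v σ) (v ++ x) (shifts-tail s v σ m′)))
                           (value-run (next s S) v x m)))
      ... | no _ = trans (cong (λ as → value (next s S) (proj₁ σ , as) (v ++ x)) (unshifts-shifts s v (proj₂ σ)))
                         (value-run (next s S) v x m)

      run-type : ∀ S v {σ} → σ ∈ schemes → shifts v σ ∈ schemes → proj₁ S (shifts v σ) ≡ proj₁ (run S v) σ
      run-type S v m m′ = trans (sym (value-fits S _ (v ++ []) m′)) (value-run S v [] m)

      Long : Word → Set
      Long w = L < length w

      -- The only possible address as seen from the ancestor at depth k + 1: roots of schemes have
      -- length at most `k`, local words have length above `k`.
      localise : Word → Slot
      localise w with length w ≤? k
      ... | yes _ = abs w
      ... | no _  = loc (drop (suc k) w)

      -- In an instance of a scheme, an argument longer than `L` must be local, so its first k + 1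
      -- letters name the ancestor common to all local arguments, whichever long argument was found.
      -- Atoms that are no such instance receive arbitrary values.
      R : ℕ × List Word → Bool
      R (p , ws) with Any.any? (λ w → L <? length w) ws
      ... | no _ = G (p , ws)
      ... | yes long with find long
      ...   | u , _ with length (take (suc k) u) ≟ suc k
      ...     | yes l = value (start (take (suc k) u) l) (p , map localise ws) (drop (suc k) u)
      -- An unreachable default: a word longer than `L` has more than k + 1 letters.
      ...     | no _  = false

      private
        localise-inst : ∀ t v → length t ≡ suc k → ∀ a → size a ≤ k → localise (inst (t ++ v) a) ≡ shift v a
        localise-inst t v l (abs w) h with length w ≤? k
        ... | yes _ = refl
        ... | no n  = ⊥-elim (n h)
        localise-inst t v l (loc w) h with length ((t ++ v) ++ w) ≤? k
        ... | no _  = cong loc (drop-prefix t v w l)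
        ... | yes q = ⊥-elim (<⇒≱ (subst (_≤ length t) l ≤-refl) (≤-trans t≤ q))
          where
          t≤ : length t ≤ length ((t ++ v) ++ w)
          t≤ = subst (length t ≤_) (sym (trans (cong length (++-assoc t v w)) (length-++ t))) (m≤m+n _ _)

        short-fits : ∀ t v → length t ≡ suc k → ∀ a → size a ≤ k → ¬ Long (inst (t ++ v) a) → size (shift v a) ≤ k
        short-fits t v l (abs w) h n = h
        short-fits t v l (loc w) h n = +-cancelˡ-≤ (suc k) _ _
          (subst (_≤ L) (trans (cong length (++-assoc t v w)) (trans (length-++ t) (cong (_+ length (v ++ w)) l))) (≮⇒≥ n))

        start-irr : ∀ {t t′} (e : t′ ≡ t) l l′ → start t′ l′ ≡ start t l
        start-irr refl l l′ = cong (start _) (≡-irrelevant l′ l)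

      -- If no argument exceeds `L`, all slots already fit the window at `t`, so `Starts` gives the
      -- value `G` there and `run-type` carries it along `v`. Otherwise `value-run` is applied along
      -- the path to a long argument.
      R-instances : ∀ t l v {σ} → σ ∈ schemes → R (instances (t ++ v) σ) ≡ proj₁ (run (start t l) v) σ
      R-instances t l v {p , as} m with Any.any? (λ w → L <? length w) (map (inst (t ++ v)) as)
      ... | no n = trans (cong G (instances-++ t v (p , as)))
                  (trans (sym (start-type t l fits)) (run-type (start t l) v m fits))
        where
        fits : shifts v (p , as) ∈ schemes
        fits = let (q , h) = schemes⁻ m in
          schemes⁺ p (map (shift v) as) (subst (λ n → (p , n) ∈ predicates) (sym (length-map (shift v) as)) q)
            λ b∈ → let (a , a∈ , eq) = ∈-map⁻ (shift v) b∈ in subst (λ b → size b ≤ k) (sym eq)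
              (short-fits t v l a (h a∈) λ lg → n (lose (∈-map⁺ (inst (t ++ v)) a∈) lg))
      ... | yes long with find long
      ...   | u , u∈ , lg with ∈-map⁻ (inst (t ++ v)) u∈
      ...     | abs w , a∈ , refl =
        ⊥-elim (<⇒≱ lg (≤-trans (proj₂ (schemes⁻ m) a∈) (m≤n+m k (suc k))))
      ...     | loc w , a∈ , refl with length (take (suc k) ((t ++ v) ++ w)) ≟ suc k
      ...       | no n = ⊥-elim (n (trans (cong length (take-prefix t v w l)) l))
      ...       | yes l′ =
          trans (cong (λ S → value S (p , map localise (map (inst (t ++ v)) as)) (drop (suc k) ((t ++ v) ++ w)))
                      (start-irr (take-prefix t v w l) l l′))
         (trans (cong₂ (λ bs x → value (start t l) (p , bs) x) localised (drop-prefix t v w l))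
                (value-run (start t l) v w m))
        where
        localised : map localise (map (inst (t ++ v)) as) ≡ map (shift v) as
        localised = trans (sym (map-∘ as)) (map-cong-local (All.tabulate λ {a} a∈ →
          localise-inst t v l a (proj₂ (schemes⁻ m) a∈)))

      R-ground : ∀ {α} → All (λ w → length w ≤ L) (proj₂ α) → R α ≡ G α
      R-ground {p , ws} h with Any.any? (λ w → L <? length w) ws
      ... | no _     = refl
      ... | yes long = let (w , w∈ , lg) = find long in ⊥-elim (<⇒≱ lg (All.lookup h w∈))

      model : ∀ t → Holds (λ σ → R (instances t σ) ≡ true) χ
      model t with length t ≤? k
      ... | yes l = holds-map χ (λ {σ} m → let eq = R-ground {instances t σ} (short (literals⊆schemes m)) in trans eq , trans (sym eq))
                      (All.lookup (proj₁ cons) (words≤⁺ k t l))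
        where
        short : ∀ {σ} → σ ∈ schemes → All (λ w → length w ≤ L) (map (inst t) (proj₂ σ))
        short m = All.tabulate λ w∈ → let (a , a∈ , eq) = ∈-map⁻ (inst t) w∈ in
          subst (λ w → length w ≤ L) (sym eq) (size-inst t a (m≤n⇒m≤1+n l) (proj₂ (schemes⁻ m) a∈))
      ... | no n = subst (λ t → Holds (λ σ → R (instances t σ) ≡ true) χ) (List.take++drop≡id (suc k) t)
          (holds-map χ (λ m → let eq = R-instances (take (suc k) t) l (drop (suc k) t) (literals⊆schemes m)
                              in trans eq , trans (sym eq))
            (All.lookup (proj₁ (proj₂ cons)) (proj₂ S)))
        where
        l : length (take (suc k) t) ≡ suc k
        l = trans (List.length-take (suc k) t) (m≤n⇒m⊓n≡m (≰⇒> n))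
        S : State
        S = run (start (take (suc k) t) l) (drop (suc k) t)

    certificate⇒model : Certificate → Σ (ℕ × List Word → Bool) λ R → ∀ t → Holds (λ σ → R (instances t σ) ≡ true) χ
    certificate⇒model c = let (G , _ , c′) = find c ; (T , _ , cons) = find c′ in Model.R {G} {T} cons , Model.model {G} {T} cons

    -- The converse: in a structure where every element has admissible children, the
    -- types of the labelled trees of depth k form a consistent set.
    module Realised (D : Set) (Rel : ℕ → List D → Set) (Valid : D → (Sym → D) → Set)
                    (total : ∀ d → ¬¬ Σ (Sym → D) (Valid d)) (d₀ : D) where

      data Tree : ℕ → D → Set where
        leaf : ∀ {d} → Tree zero d
        node : ∀ {n d} (e : Sym → D) → Valid d e → (∀ s → Tree n (e s)) → Tree (suc n) d

      label : ∀ {n d} → Tree n d → Word → D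
      label {d = d} τ             []      = d
      -- Below a leaf the label is a default value.
      label {d = d} leaf          (s ∷ w) = d
      label         (node e v τs) (s ∷ w) = label (τs s) w

      label-valid : ∀ {n d} (τ : Tree n d) w → length w < n → Valid (label τ w) (λ s → label τ (w ++ s ∷ []))
      label-valid (node e v τs) []      _       = v
      label-valid (node e v τs) (s ∷ w) (s≤s l) = label-valid (τs s) w l

      eval : ∀ {m n d} → Tree m d₀ → Tree n d → Slot → D
      eval τ₀ τ (abs w) = label τ₀ w
      eval τ₀ τ (loc w) = label τ w

      True : ∀ {m n d} → Tree m d₀ → Tree n d → Scheme → Set
      True τ₀ τ (p , as) = Rel p (map (eval τ₀ τ) as)

      private
        ¬¬-syms : ∀ {P : Sym → Set} → (∀ s → ¬¬ P s) → ¬¬ (∀ s → P s)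
        ¬¬-syms h = ¬¬-all syms (λ {s} _ → h s) >>= λ ps → return λ s → All.lookup ps (complete s)

      Extends : ∀ {n d} → Tree (suc n) d → Tree n d → Set
      Extends {n} τ′ τ = ∀ w → length w ≤ n → label τ′ w ≡ label τ w

      -- Below a child, a tree of depth `k` has only depth k - 1, too little for a type. A further
      -- layer at the leaves supplies the missing level without changing the labels already present.
      extend : ∀ {n d} (τ : Tree n d) → ¬¬ Σ (Tree (suc n) d) λ τ′ → Extends τ′ τ
      extend {d = d} leaf = total d >>= λ (e , v) → return (node e v (λ _ → leaf) , λ { [] _ → refl })
      extend (node e v τs) = ¬¬-syms (λ s → extend (τs s)) >>= λ τs′ →
        return (node e v (proj₁ ∘ τs′) , λ { [] _ → refl ; (s ∷ w) (s≤s l) → proj₂ (τs′ s) w l })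

      grow : ∀ n d → ¬¬ Tree n d
      grow zero    d = return leaf
      grow (suc n) d = grow n d >>= λ τ → extend τ >>= λ (τ′ , _) → return τ′

      descend : ∀ (t : Word) {n d} → Tree (length t + n) d → Σ D (Tree n)
      descend []      τ             = _ , τ
      descend (s ∷ t) (node e v τs) = descend t (τs s)

      label-descend : ∀ (t : Word) {n d} (τ : Tree (length t + n) d) w → label (proj₂ (descend t τ)) w ≡ label τ (t ++ w)
      label-descend []      τ             w = refl
      label-descend (s ∷ t) (node e v τs) w = label-descend t (τs s) w

      module _ (sound : ∀ {m n d} (τ₀ : Tree m d₀) (τ : Tree n d) → k ≤ m → k ≤ n → Holds (True τ₀ τ) χ) where

        private
          module _ (τ₀ : Tree L d₀) where

            IsType : Type → Set
            IsType A = Σ D λ d → Σ (Tree k d) λ τ → A reflects True τ₀ τ on schemes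

            k≤L : k ≤ L
            k≤L = m≤n+m k (suc k)

            below : ∀ t n → L ≡ length t + n → Σ (Σ D (Tree n)) λ (d , τ) → ∀ w → label τ w ≡ label τ₀ (t ++ w)
            below t n eq = descend t τ₀′ , λ w → trans (label-descend t τ₀′ w) (label-subst eq (t ++ w))
              where
              τ₀′ : Tree (length t + n) d₀
              τ₀′ = subst (λ n → Tree n d₀) eq τ₀
              label-subst : ∀ {n} (eq : L ≡ n) w → label (subst (λ n → Tree n d₀) eq τ₀) w ≡ label τ₀ w
              label-subst refl w = refl

            eval-inst : ∀ t {n d} (τ : Tree n d) → (∀ w → label τ w ≡ label τ₀ (t ++ w)) →
                        ∀ as → map (eval τ₀ τ) as ≡ map (label τ₀) (map (inst t) as)
            eval-inst t τ h as = trans (map-cong (λ { (abs w) → refl ; (loc w) → h w }) as) (map-∘ as)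

            type : ∀ {n d} (τ : Tree n d) → ¬¬ ∃ λ A → A ∈ functions schemes × A reflects True τ₀ τ on schemes
            type τ = functions-complete (True τ₀ τ) schemes

            module _ {G : ℕ × List Word → Bool} (Gr : G reflects (λ (p , ws) → Rel p (map (label τ₀) ws)) on groundAtoms)
                     {T : List Type} (T-sound : ∀ A → A ∈ T → IsType A)
                     (T-complete : ∀ A → A ∈ functions schemes → IsType A → A ∈ T) where

              G-reflects : ∀ t → length t ≤ suc k → ∀ {n d} (τ : Tree n d) → (∀ w → label τ w ≡ label τ₀ (t ++ w)) →
                           (λ σ → G (instances t σ)) reflects True τ₀ τ on schemes
              G-reflects t l τ h {p , as} m = let (f , g) = Gr (instances-ground t (p , as) l m) ; eq = eval-inst t τ h as in
                subst (Rel p) (sym eq) ∘ f , g ∘ subst (Rel p) eq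

              shallow : All (λ t → Holds (λ σ → G (instances t σ) ≡ true) χ) (words≤ k)
              shallow = All.tabulate λ {t} t∈ →
                let l = m≤n⇒m≤1+n (words≤⁻ k t∈)
                    ((d , τ) , h) = below t ((suc k ∸ length t) + k)
                                      (trans (cong (_+ k) (sym (m+[n∸m]≡n l))) (+-assoc (length t) _ k))
                in holds-map χ (λ m → let (f , g) = G-reflects t l τ h (literals⊆schemes m) in g , f)
                     (sound τ₀ τ k≤L (m≤n+m k _))

              typed : All (λ A → Holds (λ σ → A σ ≡ true) χ) T
              typed = All.tabulate λ {A} A∈ → let (d , τ , r) = T-sound A A∈ in
                holds-map χ (λ m → let (f , g) = r (literals⊆schemes m) in g , f) (sound τ₀ τ k≤L ≤-refl)

              succeeds : ∀ {A d d′ s} (τ : Tree k d) → A reflects True τ₀ τ on schemes →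
                         (τ′ : Tree k d′) → (∀ w → suc (length w) ≤ k → label τ′ w ≡ label τ (s ∷ w)) →
                         ∀ {B} → B reflects True τ₀ τ′ on schemes → Successor s A B
              succeeds {s = s} τ r τ′ h r′ = All.tabulate λ { {p , as} m m′ →
                let eq = trans (map-cong-local (All.tabulate λ {a} a∈ → agree a (proj₂ (schemes⁻ m′) (∈-map⁺ (shift (s ∷ [])) a∈))))
                               (map-∘ as)
                in reflects-≡ (r′ m) (r m′) (subst (Rel p) eq) (subst (Rel p) (sym eq)) }
                where
                agree : ∀ a → size (shift (s ∷ []) a) ≤ k → eval τ₀ τ′ a ≡ eval τ₀ τ (shift (s ∷ []) a)
                agree (abs w) _ = refl
                agree (loc w) l = h w l

              closed-under : ¬¬ All (λ A → All (λ s → Any (Successor s A) T) syms) T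
              closed-under = ¬¬-all T λ {A} A∈ → let (d , τ , r) = T-sound A A∈ in
                extend τ >>= λ where
                  (node e v τs , ext) → ¬¬-all syms λ {s} _ → type (τs s) >>= λ (B , B∈ , r′) →
                    return (lose (T-complete B B∈ (e s , τs s , r′))
                      (succeeds τ r (τs s) (λ w l → ext (s ∷ w) l) r′))

              started : ¬¬ All (λ t → Any (Starts G t) T) (tuples (suc k) syms)
              started = ¬¬-all (tuples (suc k) syms) λ {t} t∈ →
                let l = proj₂ (tuples⁻ (suc k) syms t∈)
                    ((d , τ) , h) = below t k (cong (_+ k) (sym l))
                in type τ >>= λ (A , A∈ , r) → return (lose (T-complete A A∈ (d , τ , r))
                     (All.tabulate λ m → reflects-≡ (r m) (G-reflects t (≤-reflexive l) τ h m) id id))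

        certificate : Certificate
        certificate = decidable-stable certificate? (
          grow L d₀ >>= λ τ₀ →
          Ground.functions-complete (λ (p , ws) → Rel p (map (label τ₀) ws)) groundAtoms >>= λ (G , G∈ , r) →
          comprehension (IsType τ₀) (functions schemes) >>= λ (T , T∈ , s , c) →
          closed-under τ₀ r s c >>= λ h₁ → started τ₀ r s c >>= λ h₂ →
          return (lose G∈ (lose T∈ (shallow τ₀ r s c , typed τ₀ r s c , h₁ , h₂))))

-- Skolemization

Outer : Fm → Set
Outer (A ⩓ B)   = Outer A × Outer B
Outer (A ⩔ B)   = ⊥
Outer (ex v A)  = Outer A
Outer (all v A) = NoAll A
Outer _         = ⊤

-- A disjunction outside all ∀ is decided once for the whole structure; one below a ∀ may be decided
-- differently at each element and therefore stays in the constraint.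
choices : Fm → List Fm
choices (A ⩓ B)  = cartesianProductWith _⩓_ (choices A) (choices B)
choices (A ⩔ B)  = choices A ++ choices B
choices (ex v A) = map (ex v) (choices A)
choices A        = A ∷ []

choices-outer : ∀ A → NoNestedAll A → ∀ {C} → C ∈ choices A → Outer C
choices-outer (lit b a) n (here refl) = tt
choices-outer ⊤ᶠ        n (here refl) = tt
choices-outer ⊥ᶠ        n (here refl) = tt
choices-outer (A ⩓ B) (m , n) C∈ with ∈-cartesianProductWith⁻ _⩓_ (choices A) (choices B) C∈
... | _ , _ , p , q , refl = choices-outer A m p , choices-outer B n q
choices-outer (A ⩔ B) (m , n) C∈ = [ choices-outer A m , choices-outer B n ]′ (∈-++⁻ (choices A) C∈)
choices-outer (ex v A)  n C∈ with ∈-map⁻ (ex v) C∈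
... | _ , p , refl = choices-outer A n p
choices-outer (all v A) n (here refl) = n

module _ (M : Structure) where

  choices-sound : ∀ A {C ρ} → C ∈ choices A → Strong.sat M ρ C → Strong.sat M ρ A
  choices-sound (lit b a) (here refl) s = s
  choices-sound ⊤ᶠ        (here refl) s = s
  choices-sound ⊥ᶠ        (here refl) s = s
  choices-sound (A ⩓ B) C∈ s with ∈-cartesianProductWith⁻ _⩓_ (choices A) (choices B) C∈
  choices-sound (A ⩓ B) C∈ (s , t) | _ , _ , p , q , refl = choices-sound A p s , choices-sound B q t
  choices-sound (A ⩔ B) C∈ s with ∈-++⁻ (choices A) C∈
  ... | inj₁ p = inj₁ (choices-sound A p s)
  ... | inj₂ p = inj₂ (choices-sound B p s)
  choices-sound (ex v A)  C∈ s with ∈-map⁻ (ex v) C∈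
  choices-sound (ex v A)  C∈ (d , s) | _ , p , refl = d , choices-sound A p s
  choices-sound (all v A) (here refl) s = s

  choices-complete : ∀ A {ρ} → Classical.sat M ρ A → ¬¬ ∃ λ C → C ∈ choices A × Classical.sat M ρ C
  choices-complete (lit b a) s = return (lit b a , here refl , s)
  choices-complete ⊤ᶠ        s = return (⊤ᶠ , here refl , s)
  choices-complete ⊥ᶠ        s = return (⊥ᶠ , here refl , s)
  choices-complete (A ⩓ B) (s , t) =
    choices-complete A s >>= λ (C , p , s′) → choices-complete B t >>= λ (D , q , t′) →
    return (C ⩓ D , ∈-cartesianProductWith⁺ _⩓_ p q , s′ , t′)
  choices-complete (A ⩔ B) s = s >>= λ where
    (inj₁ s) → choices-complete A s >>= λ (C , p , s′) → return (C , ∈-++⁺ˡ p , s′)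
    (inj₂ s) → choices-complete B s >>= λ (C , p , s′) → return (C , ∈-++⁺ʳ (choices A) p , s′)
  choices-complete (ex v A)  s = s >>= λ (d , s) → choices-complete A s >>= λ (C , p , s′) →
    return (ex v C , ∈-map⁺ (ex v) p , return (d , s′))
  choices-complete (all v A) s = return (all v A , here refl , s)

-- Finite alphabets of symbols

data Code : Set where
  ∅   : Code
  _+1 : Code → Code
  _⊕_ : Code → Code → Code

El : Code → Set
El ∅       = ⊥
El (c +1)  = Maybe (El c)
El (c ⊕ d) = El c ⊎ El d

elements : ∀ c → List (El c)
elements ∅       = []
elements (c +1)  = nothing ∷ map just (elements c)
elements (c ⊕ d) = map inj₁ (elements c) ++ map inj₂ (elements d)

elements-complete : ∀ c (i : El c) → i ∈ elements c
elements-complete (c +1)  nothing  = here refl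
elements-complete (c +1)  (just i) = there (∈-map⁺ just (elements-complete c i))
elements-complete (c ⊕ d) (inj₁ i) = ∈-++⁺ˡ (∈-map⁺ inj₁ (elements-complete c i))
elements-complete (c ⊕ d) (inj₂ i) = ∈-++⁺ʳ (map inj₁ (elements c)) (∈-map⁺ inj₂ (elements-complete d i))

El-≟ : ∀ c → DecidableEquality (El c)
El-≟ (c +1)  = Maybe.≡-dec (El-≟ c)
El-≟ (c ⊕ d) = Sum.≡-dec (El-≟ c) (El-≟ d)

upTo : ℕ → Code
upTo zero    = ∅ +1
upTo (suc n) = upTo n +1

-- Symbols above the bound n are identified with n.
encode : ∀ n → ℕ → El (upTo n)
encode zero    f       = nothing
encode (suc n) zero    = nothing
encode (suc n) (suc f) = just (encode n f)

decode : ∀ n → El (upTo n) → ℕ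
decode zero    _        = zero
decode (suc n) nothing  = zero
decode (suc n) (just i) = suc (decode n i)

decode-encode : ∀ n {f} → f ≤ n → decode n (encode n f) ≡ f
decode-encode zero    z≤n           = refl
decode-encode (suc n) {zero}  _     = refl
decode-encode (suc n) {suc f} (s≤s l) = cong suc (decode-encode n l)

maxSymT : Term → ℕ
maxSymT (var v)   = 0
maxSymT (con c)   = c
maxSymT (fun f t) = f ⊔ maxSymT t

maxSymTs : List Term → ℕ
maxSymTs = foldr (λ t n → maxSymT t ⊔ n) 0

maxSym : Fm → ℕ
maxSym (lit b (atom p ts)) = maxSymTs ts
maxSym ⊤ᶠ        = 0
maxSym ⊥ᶠ        = 0
maxSym (A ⩓ B)   = maxSym A ⊔ maxSym B
maxSym (A ⩔ B)   = maxSym A ⊔ maxSym B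
maxSym (ex v A)  = maxSym A
maxSym (all v A) = maxSym A

-- The code follows the shape of the formula, so `inj₁`, `inj₂` and `just` pick out the Skolem
-- symbols of a subformula.
scopedEx : Fm → Code
scopedEx (A ⩓ B)  = scopedEx A ⊕ scopedEx B
scopedEx (A ⩔ B)  = scopedEx A ⊕ scopedEx B
scopedEx (ex v A) = scopedEx A +1
scopedEx _        = ∅

-- Existentials outside every ∀ become Skolem constants. Those below a ∀ become Skolem functions,
-- and these are unary because universals are not nested; this keeps all terms words.
outerEx innerEx : Fm → Code
outerEx (A ⩓ B)  = outerEx A ⊕ outerEx B
outerEx (ex v A) = outerEx A +1
outerEx _        = ∅
innerEx (A ⩓ B)   = innerEx A ⊕ innerEx B
innerEx (ex v A)  = innerEx A
innerEx (all v A) = scopedEx A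
innerEx _         = ∅

-- Skolemization into one constraint on nodes

module Skolem (θ : Fm) where

  N : ℕ
  N = maxSym θ

  -- Constants and Skolem constants are letters too, which turns every ground term into a word; the
  -- translation uses them only as the first letter of a root.
  symbols : Code
  symbols = upTo N ⊕ (upTo N ⊕ (outerEx θ ⊕ innerEx θ))

  Sym : Set
  Sym = El symbols

  fnSym conSym : El (upTo N) → Sym
  fnSym  = inj₁
  conSym = inj₂ ∘ inj₁

  outerSym : El (outerEx θ) → Sym
  outerSym = inj₂ ∘ inj₂ ∘ inj₁

  innerSym : El (innerEx θ) → Sym
  innerSym = inj₂ ∘ inj₂ ∘ inj₂

  open Paths Sym (El-≟ symbols) (elements symbols) (elements-complete symbols)

  SlotEnv : Set
  SlotEnv = Var → Slot

  bindSlot : SlotEnv → Var → Slot → SlotEnv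
  bindSlot ε v a w = if w ≡ᵇ v then a else ε w

  snoc : Slot → Sym → Slot
  snoc (abs w) s = abs (w ++ s ∷ [])
  snoc (loc w) s = loc (w ++ s ∷ [])

  slotT : SlotEnv → Term → Slot
  slotT ε (var v)   = ε v
  slotT ε (con c)   = abs (conSym (encode N c) ∷ [])
  slotT ε (fun f t) = snoc (slotT ε t) (fnSym (encode N f))

  scheme : SlotEnv → Atom → Scheme
  scheme ε (atom p ts) = p , map (slotT ε) ts

  skInner : ∀ A → (El (scopedEx A) → Sym) → SlotEnv → Constraint Scheme
  skInner (lit b a) i ε = litᶜ b (scheme ε a)
  skInner ⊤ᶠ        i ε = ⊤ᶜ
  skInner ⊥ᶠ        i ε = ⊥ᶜ
  skInner (A ⩓ B)   i ε = skInner A (i ∘ inj₁) ε ∧ᶜ skInner B (i ∘ inj₂) ε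
  skInner (A ⩔ B)   i ε = skInner A (i ∘ inj₁) ε ∨ᶜ skInner B (i ∘ inj₂) ε
  skInner (ex v A)  i ε = skInner A (i ∘ just) (bindSlot ε v (loc (i nothing ∷ [])))
  skInner (all v A) i ε = ⊥ᶜ

  -- All universal conjuncts share one current node, since ∀x α(x) ∧ ∀y β(y) is ∀t (α(t) ∧ β(t)).
  -- Disjunction does not commute with ∀t in this way, which is why `choices` has removed it at this
  -- level.
  skOuter : ∀ A → (El (outerEx A) → Sym) → (El (innerEx A) → Sym) → SlotEnv → Constraint Scheme
  skOuter (lit b a) o i ε = litᶜ b (scheme ε a)
  skOuter ⊤ᶠ        o i ε = ⊤ᶜ
  skOuter ⊥ᶠ        o i ε = ⊥ᶜ
  skOuter (A ⩓ B)   o i ε = skOuter A (o ∘ inj₁) (i ∘ inj₁) ε ∧ᶜ skOuter B (o ∘ inj₂) (i ∘ inj₂) ε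
  skOuter (A ⩔ B)   o i ε = ⊥ᶜ
  skOuter (ex v A)  o i ε = skOuter A (o ∘ just) i (bindSlot ε v (abs (o nothing ∷ [])))
  skOuter (all v A) o i ε = skInner A i (bindSlot ε v (loc []))

  χ : Constraint Scheme
  -- The empty word stands for `elem`, the value of every variable under the initial assignment.
  χ = skOuter θ outerSym innerSym (λ _ → abs [])

  open Problem χ public

  -- From certificates to models

  module TreeModel (R : ℕ × List Word → Bool) where

    H : Structure
    H = record { Dom = Word ; elem = [] ; cst = λ c → conSym (encode N c) ∷ []
               ; fn = λ f t → t ++ fnSym (encode N f) ∷ [] ; rel = λ p ws → R (p , ws) ≡ true }

    open Strong H

    Agrees : Word → Env H → SlotEnv → Set
    Agrees t ρ ε = ∀ v → ρ v ≡ inst t (ε v)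

    agrees-bind : ∀ {t ρ ε} v {d a} → d ≡ inst t a → Agrees t ρ ε → Agrees t (_[_↦_] H ρ v d) (bindSlot ε v a)
    agrees-bind v eq h w with w ≡ᵇ v
    ... | true  = eq
    ... | false = h w

    inst-snoc : ∀ t a s → inst t (snoc a s) ≡ inst t a ++ s ∷ []
    inst-snoc t (abs w) s = refl
    inst-snoc t (loc w) s = sym (++-assoc t w (s ∷ []))

    evalT-inst : ∀ {t ρ ε} → Agrees t ρ ε → ∀ u → evalT H ρ u ≡ inst t (slotT ε u)
    evalT-inst h (var v)   = h v
    evalT-inst h (con c)   = refl
    evalT-inst {t} {ε = ε} h (fun f u) =
      trans (cong (_++ fnSym (encode N f) ∷ []) (evalT-inst h u)) (sym (inst-snoc t (slotT ε u) _))

    evalTs-inst : ∀ {t ρ ε} → Agrees t ρ ε → ∀ us → map (evalT H ρ) us ≡ map (inst t) (map (slotT ε) us)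
    evalTs-inst h []       = refl
    evalTs-inst h (u ∷ us) = cong₂ _∷_ (evalT-inst h u) (evalTs-inst h us)

    TrueAt : Word → Scheme → Set
    TrueAt t σ = R (instances t σ) ≡ true

    lit-sound : ∀ {t ρ ε} → Agrees t ρ ε → ∀ b a → Holds (TrueAt t) (litᶜ b (scheme ε a)) → sat ρ (lit b a)
    lit-sound h true  (atom p us) s = trans (cong (λ ws → R (p , ws)) (evalTs-inst h us)) s
    lit-sound h false (atom p us) n = λ s → n (trans (cong (λ ws → R (p , ws)) (sym (evalTs-inst h us))) s)

    skInner-sound : ∀ A i {t ρ ε} → Agrees t ρ ε → Holds (TrueAt t) (skInner A i ε) → sat ρ A
    skInner-sound (lit b a) i h s        = lit-sound h b a s
    skInner-sound ⊤ᶠ        i h s        = tt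
    skInner-sound (A ⩓ B)   i h (s , s′) = skInner-sound A _ h s , skInner-sound B _ h s′
    skInner-sound (A ⩔ B)   i h (inj₁ s) = inj₁ (skInner-sound A _ h s)
    skInner-sound (A ⩔ B)   i h (inj₂ s) = inj₂ (skInner-sound B _ h s)
    skInner-sound (ex v A)  i {t} h s    = t ++ i nothing ∷ [] , skInner-sound A _ (agrees-bind v refl h) s

    skOuter-sound : ∀ A o i {ρ ε} → (∀ t → Agrees t ρ ε) → (∀ t → Holds (TrueAt t) (skOuter A o i ε)) → sat ρ A
    -- The hypotheses hold at every node, and outside ∀ a single one suffices; the root of the tree
    -- is taken.
    skOuter-sound (lit b a) o i h s   = lit-sound (h []) b a (s [])
    skOuter-sound ⊤ᶠ        o i h s   = tt
    skOuter-sound ⊥ᶠ        o i h s   = s []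
    skOuter-sound (A ⩓ B)   o i h s   =
      skOuter-sound A _ _ h (proj₁ ∘ s) , skOuter-sound B _ _ h (proj₂ ∘ s)
    skOuter-sound (A ⩔ B)   o i h s   = ⊥-elim (s [])
    skOuter-sound (ex v A)  o i h s   = o nothing ∷ [] , skOuter-sound A _ _ (λ t → agrees-bind v refl (h t)) s
    skOuter-sound (all v A) o i h s t =
      skInner-sound A i (agrees-bind v (sym (++-identityʳ t)) (h t)) (s t)

  certificate⇒satisfied : Certificate → Σ Structure λ H → Strong.sat H (λ _ → Structure.elem H) θ
  certificate⇒satisfied c = let (R , h) = certificate⇒model c in
    TreeModel.H R , TreeModel.skOuter-sound R θ outerSym innerSym (λ t v → refl) h

  -- From models to certificates

  module _ (M : Structure) where
    open Structure M

    private
      upd : Env M → Var → Dom → Env M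
      upd = _[_↦_] M

    open Classical M using (sat)

    LitTrue : Env M → Bool → Atom → Set
    LitTrue ρ true  a = holdsA M ρ a
    LitTrue ρ false a = ¬ holdsA M ρ a

    Inner : ∀ A → (El (scopedEx A) → Dom) → Env M → Set
    Inner (lit b a) i ρ = LitTrue ρ b a
    Inner ⊤ᶠ        i ρ = ⊤
    Inner ⊥ᶠ        i ρ = ⊥
    Inner (A ⩓ B)   i ρ = Inner A (i ∘ inj₁) ρ × Inner B (i ∘ inj₂) ρ
    Inner (A ⩔ B)   i ρ = Inner A (i ∘ inj₁) ρ ⊎ Inner B (i ∘ inj₂) ρ
    Inner (ex v A)  i ρ = Inner A (i ∘ just) (upd ρ v (i nothing))
    Inner (all v A) i ρ = ⊥

    -- The Skolemized formula at the single point `d`, with witnesses given as elements in place of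
    -- functions.
    AtPoint : ∀ A → (El (outerEx A) → Dom) → (El (innerEx A) → Dom) → Env M → Dom → Set
    AtPoint (lit b a) o i ρ d = LitTrue ρ b a
    AtPoint ⊤ᶠ        o i ρ d = ⊤
    AtPoint ⊥ᶠ        o i ρ d = ⊥
    AtPoint (A ⩓ B)   o i ρ d = AtPoint A (o ∘ inj₁) (i ∘ inj₁) ρ d × AtPoint B (o ∘ inj₂) (i ∘ inj₂) ρ d
    AtPoint (A ⩔ B)   o i ρ d = ⊥
    AtPoint (ex v A)  o i ρ d = AtPoint A (o ∘ just) i (upd ρ v (o nothing)) d
    AtPoint (all v A) o i ρ d = Inner A i (upd ρ v d)

    _▹_ : ∀ {c} → Dom → (El c → Dom) → El (c +1) → Dom
    (d ▹ f) nothing  = d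
    (d ▹ f) (just j) = f j

    lit-witness : ∀ {ρ} b a → sat ρ (lit b a) → ¬¬ LitTrue ρ b a
    lit-witness true  a s = s
    lit-witness false a s = return s

    inner-witness : ∀ A {ρ} → NoAll A → sat ρ A → ¬¬ Σ (El (scopedEx A) → Dom) λ i → Inner A i ρ
    inner-witness (lit b a) n s = lit-witness b a s >>= λ p → return ((λ ()) , p)
    inner-witness ⊤ᶠ        n s = return ((λ ()) , tt)
    inner-witness ⊥ᶠ        n s = s >>= ⊥-elim
    inner-witness (A ⩓ B) (m , n) (s , t) =
      inner-witness A m s >>= λ (i , p) → inner-witness B n t >>= λ (j , q) → return ([ i , j ]′ , p , q)
    inner-witness (A ⩔ B) (m , n) s = s >>= λ where
      -- The Skolem symbols of the other disjunct need values as well and receive `elem`.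
      (inj₁ s) → inner-witness A m s >>= λ (i , p) → return ([ i , (λ _ → elem) ]′ , inj₁ p)
      (inj₂ s) → inner-witness B n s >>= λ (i , p) → return ([ (λ _ → elem) , i ]′ , inj₂ p)
    inner-witness (ex v A)  n s = s >>= λ (d , s) → inner-witness A n s >>= λ (i , p) → return (d ▹ i , p)

    -- The inner double negation stays behind ∀d: inner witnesses are obtained point by point, since
    -- moving ¬¬ out would amount to choosing them for the whole domain at once.
    outer-witness : ∀ A {ρ} → Outer A → sat ρ A → ¬¬ Σ (El (outerEx A) → Dom) λ o →
                    ∀ d → ¬¬ Σ (El (innerEx A) → Dom) λ i → AtPoint A o i ρ d
    outer-witness (lit b a) n s = lit-witness b a s >>= λ p → return ((λ ()) , λ d → return ((λ ()) , p))
    outer-witness ⊤ᶠ        n s = return ((λ ()) , λ d → return ((λ ()) , tt))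
    outer-witness ⊥ᶠ        n s = s >>= ⊥-elim
    outer-witness (A ⩓ B) (m , n) (s , t) =
      outer-witness A m s >>= λ (o , h) → outer-witness B n t >>= λ (o′ , h′) →
      return ([ o , o′ ]′ , λ d → h d >>= λ (i , p) → h′ d >>= λ (j , q) → return ([ i , j ]′ , p , q))
    outer-witness (ex v A)  n s = s >>= λ (d , s) → outer-witness A n s >>= λ (o , h) → return (d ▹ o , h)
    outer-witness (all v A) n s = return ((λ ()) , λ d → inner-witness A n (s d))

    module _ (o : El (outerEx θ) → Dom)
             (h : ∀ d → ¬¬ Σ (El (innerEx θ) → Dom) λ i → AtPoint θ o i (λ _ → elem) d) where

      -- Every node has a child for each letter, so constants and outer witnesses recur below every
      -- element; the translation reads those below the root of the tree. What varies with `d` are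
      -- the function values and the inner witnesses.
      Valid : Dom → (Sym → Dom) → Set
      Valid d e = (∀ s → e (fnSym s) ≡ fn (decode N s) d)
                × (∀ s → e (conSym s) ≡ cst (decode N s))
                × (∀ s → e (outerSym s) ≡ o s)
                × AtPoint θ o (e ∘ innerSym) (λ _ → elem) d

      total : ∀ d → ¬¬ Σ (Sym → Dom) (Valid d)
      total d = h d >>= λ (i , p) →
        return ([ (λ s → fn (decode N s) d) , [ cst ∘ decode N , [ o , i ]′ ]′ ]′
               , (λ _ → refl) , (λ _ → refl) , (λ _ → refl) , p)

      open Realised Dom rel Valid total elem

      module _ {m n d} (τ₀ : Tree m elem) (τ : Tree n d) (k≤m : k ≤ m) (k≤n : k ≤ n) where

        Agrees : Env M → SlotEnv → Set
        Agrees ρ ε = ∀ v → ρ v ≡ eval τ₀ τ (ε v)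

        agrees-bind : ∀ {ρ ε} v {c a} → c ≡ eval τ₀ τ a → Agrees ρ ε → Agrees (upd ρ v c) (bindSlot ε v a)
        agrees-bind v eq g w with w ≡ᵇ v
        ... | true  = eq
        ... | false = g w

        root₀ : Valid elem (λ s → label τ₀ (s ∷ []))
        root₀ = label-valid τ₀ [] (<-≤-trans 1≤k k≤m)

        root : Valid d (λ s → label τ (s ∷ []))
        root = label-valid τ [] (<-≤-trans 1≤k k≤n)

        private
          length-snoc : ∀ (w : Word) s → length (w ++ s ∷ []) ≡ suc (length w)
          length-snoc w s = trans (length-++ w) (+-comm (length w) 1)

        size-snoc : ∀ a s → size (snoc a s) ≡ suc (size a)
        size-snoc (abs w) s = length-snoc w s
        size-snoc (loc w) s = length-snoc w s

        eval-snoc : ∀ a f → f ≤ N → size a < k → eval τ₀ τ (snoc a (fnSym (encode N f))) ≡ fn f (eval τ₀ τ a)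
        eval-snoc (abs w) f f≤ l = trans (proj₁ (label-valid τ₀ w (<-≤-trans l k≤m)) (encode N f))
                                         (cong (λ g → fn g (label τ₀ w)) (decode-encode N f≤))
        eval-snoc (loc w) f f≤ l = trans (proj₁ (label-valid τ w (<-≤-trans l k≤n)) (encode N f))
                                         (cong (λ g → fn g (label τ w)) (decode-encode N f≤))

        evalT-eval : ∀ {ρ ε} → Agrees ρ ε → ∀ u → maxSymT u ≤ N → size (slotT ε u) ≤ k →
                     evalT M ρ u ≡ eval τ₀ τ (slotT ε u)
        evalT-eval g (var v)   b l = g v
        evalT-eval g (con c)   b l = sym (trans (proj₁ (proj₂ root₀) (encode N c)) (cong cst (decode-encode N b)))
        evalT-eval {ε = ε} g (fun f u) b l =
          let l′ = subst (_≤ k) (size-snoc (slotT ε u) _) l in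
          trans (cong (fn f) (evalT-eval g u (m⊔n≤o⇒n≤o f _ b) (≤-trans (n≤1+n _) l′)))
                (sym (eval-snoc (slotT ε u) f (m⊔n≤o⇒m≤o f _ b) l′))

        evalTs-eval : ∀ {ρ ε} → Agrees ρ ε → ∀ us → maxSymTs us ≤ N →
                      (∀ {a} → a ∈ map (slotT ε) us → size a ≤ k) →
                      map (evalT M ρ) us ≡ map (eval τ₀ τ) (map (slotT ε) us)
        evalTs-eval g []       b l = refl
        evalTs-eval g (u ∷ us) b l = cong₂ _∷_ (evalT-eval g u (m⊔n≤o⇒m≤o _ _ b) (l (here refl)))
          (evalTs-eval g us (m⊔n≤o⇒n≤o (maxSymT u) _ b) (l ∘ there))

        -- Being a literal of `χ` bounds the slots by `k`, which keeps the evaluation of terms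
        -- inside the finite trees.
        InProblem : Constraint Scheme → Set
        InProblem ξ = ∀ {σ} → σ ∈ literals ξ → σ ∈ literals χ

        lit-complete : ∀ {ρ ε} → Agrees ρ ε → ∀ b a → maxSym (lit b a) ≤ N → InProblem (litᶜ b (scheme ε a)) →
                       LitTrue ρ b a → Holds (True τ₀ τ) (litᶜ b (scheme ε a))
        lit-complete {ρ} {ε} g b (atom p us) q m = transport b
          (evalTs-eval g us q (proj₂ (schemes⁻ {p} {map (slotT ε) us} (literals⊆schemes (m (here refl))))))
          where
          transport : ∀ b → map (evalT M ρ) us ≡ map (eval τ₀ τ) (map (slotT ε) us) →
                      LitTrue ρ b (atom p us) → Holds (True τ₀ τ) (litᶜ b (scheme ε (atom p us)))
          transport true  eq s = subst (rel p) eq s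
          transport false eq s = s ∘ subst (rel p) (sym eq)

        skInner-complete : ∀ A i {ρ ε} → Agrees ρ ε → maxSym A ≤ N → InProblem (skInner A i ε) →
                           Inner A (λ j → label τ (i j ∷ [])) ρ → Holds (True τ₀ τ) (skInner A i ε)
        skInner-complete (lit b a) i g q m s = lit-complete g b a q m s
        skInner-complete ⊤ᶠ        i g q m s = tt
        skInner-complete (A ⩓ B)   i g q m (s , t) =
            skInner-complete A _ g (m⊔n≤o⇒m≤o _ _ q) (m ∘ ∈-++⁺ˡ) s
          , skInner-complete B _ g (m⊔n≤o⇒n≤o (maxSym A) _ q) (m ∘ ∈-++⁺ʳ _) t
        skInner-complete (A ⩔ B)   i g q m (inj₁ s) =
          inj₁ (skInner-complete A _ g (m⊔n≤o⇒m≤o _ _ q) (m ∘ ∈-++⁺ˡ) s)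
        skInner-complete (A ⩔ B)   i g q m (inj₂ s) =
          inj₂ (skInner-complete B _ g (m⊔n≤o⇒n≤o (maxSym A) _ q) (m ∘ ∈-++⁺ʳ _) s)
        skInner-complete (ex v A)  i g q m s = skInner-complete A _ (agrees-bind v refl g) q m s

        skOuter-complete : ∀ A o′ i {ρ ε} → Agrees ρ ε → maxSym A ≤ N → InProblem (skOuter A o′ i ε) →
                           ∀ p → (∀ j → label τ₀ (o′ j ∷ []) ≡ p j) →
                           AtPoint A p (λ j → label τ (i j ∷ [])) ρ d → Holds (True τ₀ τ) (skOuter A o′ i ε)
        skOuter-complete (lit b a) o′ i g q m p e s = lit-complete g b a q m s
        skOuter-complete ⊤ᶠ        o′ i g q m p e s = tt
        skOuter-complete (A ⩓ B)   o′ i g q m p e (s , t) =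
            skOuter-complete A _ _ g (m⊔n≤o⇒m≤o _ _ q) (m ∘ ∈-++⁺ˡ) _ (e ∘ inj₁) s
          , skOuter-complete B _ _ g (m⊔n≤o⇒n≤o (maxSym A) _ q) (m ∘ ∈-++⁺ʳ _) _ (e ∘ inj₂) t
        skOuter-complete (ex v A)  o′ i g q m p e s =
          skOuter-complete A _ _ (agrees-bind v (sym (e nothing)) g) q m _ (e ∘ just) s
        skOuter-complete (all v A) o′ i g q m p e s = skInner-complete A i (agrees-bind v refl g) q m s

        sound : Holds (True τ₀ τ) χ
        sound = skOuter-complete θ outerSym innerSym (λ _ → refl) ≤-refl id o
                  (proj₁ (proj₂ (proj₂ root₀))) (proj₂ (proj₂ (proj₂ root)))

      realised-certificate : Certificate
      realised-certificate = certificate sound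

    satisfied⇒certificate : Outer θ → sat (λ _ → elem) θ → ¬¬ Certificate
    satisfied⇒certificate n s = outer-witness θ n s >>= λ (o , h) → return (realised-certificate o h)

-- The decision procedure

module _ (φ : Sentence) where

  miniscoped : Fm
  miniscoped = miniscope (prefix φ) (matrix φ)

  Certified : Set
  Certified = Any Skolem.Certificate (choices miniscoped)

  certified? : Dec Certified
  certified? = Any.any? Skolem.certificate? (choices miniscoped)

  certified⇒satisfiable : Certified → Satisfiable φ
  certified⇒satisfiable c = satisfied (find c)
    where
    satisfied : (∃ λ θ → θ ∈ choices miniscoped × Skolem.Certificate θ) → Satisfiable φ
    satisfied (θ , θ∈ , cert) = let (H , s) = Skolem.certificate⇒satisfied θ cert in
      H , miniscope-sound H (prefix φ) (matrix φ) _ (choices-sound H miniscoped θ∈ s)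

  satisfiable⇒certified : IsGAF φ → Satisfiable φ → Certified
  satisfiable⇒certified (std , lab , gaf) (M , s) = decidable-stable certified?
    (choices-complete M miniscoped (miniscope-complete M (prefix φ) (matrix φ) _ s) >>= λ (θ , θ∈ , t) →
     Skolem.satisfied⇒certificate θ M (choices-outer miniscoped (miniscope-flat φ lab std gaf) θ∈) t >>= λ cert →
     return (lose θ∈ cert))

theorem7 : (φ : Sentence) → IsGAF φ → Dec (Satisfiable φ)
theorem7 φ gaf = map′ (certified⇒satisfiable φ) (satisfiable⇒certified φ gaf) (certified? φ)
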